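{- There exist computably enumerable equivalence relations $R$ and $S$ on $\omega$, each with infinitely many equivalence classes, such that the reducibility spectrum $\mathrm{DgSp}_{\Rightarrow}(R,S)$ has no basis.
   Context: For equivalence relations $R,S$ on $\omega$ and a Turing degree $\mathbf{d}$, write $R\leq_{\mathbf{d}} S$ if there is a $\mathbf{d}$-computable function $f:\omega\to\omega$ such that for all $x,y\in\omega$, $x R y \Leftrightarrow f(x) S f(y)$. The reducibility spectrum of $(R,S)$ is $\mathrm{DgSp}_{\Rightarrow}(R,S)=\{\mathbf{d} : R\leq_{\mathbf{d}} S\}$. An equivalence relation $R$ on $\omega$ is computably enumerable (a ceer) if the set of pairs $\{(x,y) : x R y\}$ is c.e. A set $\mathcal{B}$ of Turing degrees is a basis of a set $\mathcal{A}$ of Turing degrees if (1) the elements of $\mathcal{B}$ are pairwise Turing-incomparable, and (2) $\mathcal{A}=\{\mathbf{d} : (\exists \mathbf{b}\in\mathcal{B})(\mathbf{b}\leq\mathbf{d})\}$. -}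

module Defs where

open import Data.Fin.Base using (Fin)
open import Data.Nat.Base using (ℕ; zero; suc; _<_)
open import Data.Product.Base using (Σ; ∃; _×_; _,_; proj₁)
open import Data.Vec.Base using (Vec; []; _∷_; lookup)
open import Data.Vec.Relation.Binary.Pointwise.Inductive using (Pointwise; []; _∷_)
open import Function.Bundles using (_⇔_)
open import Function.Definitions using (Injective)
open import Level using (Level; 0ℓ; _⊔_) renaming (suc to lsuc)
open import Relation.Binary.Bundles using (Poset)
open import Relation.Binary.Core using (Rel)
open import Relation.Binary.Definitions using (_Respects_)
open import Relation.Binary.PropositionalEquality.Core using (_≡_)
open import Relation.Binary.Structures using (IsEquivalence)
open import Relation.Nullary.Negation.Core using (¬_)
open import Relation.Unary using (Pred; _∈_; _∉_; ∅)
import Relation.Binary.Construct.Interior.Symmetric as Interior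

private
  variable
    m n x y : ℕ
    A B C : Pred ℕ 0ℓ

-- Kleene's schemes for the n-ary partial recursive functions, extended by
-- the characteristic function of an oracle set.
data Code : ℕ → Set where
  zeroᶜ  : Code n
  sucᶜ   : Code 1
  proj   : Fin n → Code n
  oracle : Code 1
  comp   : Code m → Vec (Code n) m → Code n
  prec   : Code n → Code (suc (suc n)) → Code (suc n)
  μ      : Code (suc n) → Code n

-- A ⊢ c · xs ↓ y: with oracle A, the program c halts on input xs with
-- output y.
infix 4 _⊢_·_↓_

data _⊢_·_↓_ (A : Pred ℕ 0ℓ) : Code n → Vec ℕ n → ℕ → Set where

  ↓zero : {xs : Vec ℕ n} → A ⊢ zeroᶜ · xs ↓ 0

  ↓suc : A ⊢ sucᶜ · x ∷ [] ↓ suc x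

  ↓proj : {xs : Vec ℕ n} (i : Fin n) → A ⊢ proj i · xs ↓ lookup xs i

  ↓oracle-∈ : x ∈ A → A ⊢ oracle · x ∷ [] ↓ 1

  ↓oracle-∉ : x ∉ A → A ⊢ oracle · x ∷ [] ↓ 0

  ↓comp : {f : Code m} {gs : Vec (Code n) m} {xs : Vec ℕ n} {ys : Vec ℕ m} →
          Pointwise (λ g v → A ⊢ g · xs ↓ v) gs ys →
          A ⊢ f · ys ↓ y →
          A ⊢ comp f gs · xs ↓ y

  ↓prec-zero : {f : Code n} {g : Code (suc (suc n))} {xs : Vec ℕ n} →
               A ⊢ f · xs ↓ y →
               A ⊢ prec f g · 0 ∷ xs ↓ y

  ↓prec-suc : {f : Code n} {g : Code (suc (suc n))} {xs : Vec ℕ n} {r : ℕ} →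
              A ⊢ prec f g · x ∷ xs ↓ r →
              A ⊢ g · x ∷ r ∷ xs ↓ y →
              A ⊢ prec f g · suc x ∷ xs ↓ y

  -- The search requires f to converge at every argument below y.
  ↓μ : {f : Code (suc n)} {xs : Vec ℕ n} →
       (∀ i → i < y → ∃ λ k → A ⊢ f · i ∷ xs ↓ suc k) →
       A ⊢ f · y ∷ xs ↓ 0 →
       A ⊢ μ f · xs ↓ y

_-Computable_ : Pred ℕ 0ℓ → (ℕ → ℕ) → Set
A -Computable f = ∃ λ (c : Code 1) → ∀ x → A ⊢ c · x ∷ [] ↓ f x

-- Plain computability is computability from the oracle ∅, whose queries are
-- all answered 0; a c.e. set is the domain of a partial computable function.
CERel : Rel ℕ 0ℓ → Set
CERel R = ∃ λ (c : Code 2) → ∀ x y → R x y ⇔ (∃ λ z → ∅ ⊢ c · x ∷ y ∷ [] ↓ z)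

-- The characteristic function of A is computable from B.  It is described by
-- its two values because membership in A need not be decidable in Agda.
infix 4 _≤T_ _≡T_

_≤T_ : Rel (Pred ℕ 0ℓ) 0ℓ
A ≤T B = ∃ λ (c : Code 1) → ∀ x →
  (x ∈ A → B ⊢ c · x ∷ [] ↓ 1) × (x ∉ A → B ⊢ c · x ∷ [] ↓ 0)

_≡T_ : Rel (Pred ℕ 0ℓ) 0ℓ
_≡T_ = Interior.SymInterior _≤T_

-- Replacing the oracle calls of a program by calls to another program.
mutual
  _[oracle≔_] : Code n → Code 1 → Code n
  zeroᶜ     [oracle≔ o ] = zeroᶜ
  sucᶜ      [oracle≔ o ] = sucᶜ
  proj i    [oracle≔ o ] = proj i
  oracle    [oracle≔ o ] = o
  comp f gs [oracle≔ o ] = comp (f [oracle≔ o ]) (gs [oracle≔ o ]*)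
  prec f g  [oracle≔ o ] = prec (f [oracle≔ o ]) (g [oracle≔ o ])
  μ f       [oracle≔ o ] = μ (f [oracle≔ o ])

  _[oracle≔_]* : Vec (Code n) m → Code 1 → Vec (Code n) m
  []       [oracle≔ o ]* = []
  (g ∷ gs) [oracle≔ o ]* = g [oracle≔ o ] ∷ gs [oracle≔ o ]*

mutual
  ↓-subst : ((o , _) : A ≤T B) {c : Code n} {xs : Vec ℕ n} →
            A ⊢ c · xs ↓ y → B ⊢ c [oracle≔ o ] · xs ↓ y
  ↓-subst A≤B ↓zero            = ↓zero
  ↓-subst A≤B ↓suc             = ↓suc
  ↓-subst A≤B (↓proj i)        = ↓proj i
  ↓-subst (_ , χ) (↓oracle-∈ x∈A) = let (yes , _) = χ _ in yes x∈A
  ↓-subst (_ , χ) (↓oracle-∉ x∉A) = let (_ , no) = χ _ in no x∉A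
  ↓-subst A≤B (↓comp ps p)     = ↓comp (↓-subst* A≤B ps) (↓-subst A≤B p)
  ↓-subst A≤B (↓prec-zero p)   = ↓prec-zero (↓-subst A≤B p)
  ↓-subst A≤B (↓prec-suc p q)  = ↓prec-suc (↓-subst A≤B p) (↓-subst A≤B q)
  ↓-subst A≤B (↓μ ps p)        =
    ↓μ (λ i i<y → let (k , q) = ps i i<y in k , ↓-subst A≤B q) (↓-subst A≤B p)

  ↓-subst* : ((o , _) : A ≤T B) {gs : Vec (Code n) m} {xs : Vec ℕ n} {ys : Vec ℕ m} →
             Pointwise (λ g v → A ⊢ g · xs ↓ v) gs ys →
             Pointwise (λ g v → B ⊢ g · xs ↓ v) (gs [oracle≔ o ]*) ys
  ↓-subst* A≤B []       = []
  ↓-subst* A≤B (p ∷ ps) = ↓-subst A≤B p ∷ ↓-subst* A≤B ps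

≤T-refl : A ≤T A
≤T-refl = oracle , λ _ → ↓oracle-∈ , ↓oracle-∉

≤T-trans : A ≤T B → B ≤T C → A ≤T C
≤T-trans (c , χ) B≤C@(o , _) = c [oracle≔ o ] , λ x →
  let (yes , no) = χ x in
  (λ x∈A → ↓-subst B≤C (yes x∈A)) , (λ x∉A → ↓-subst B≤C (no x∉A))

-- A Turing degree is represented by any of its members, two representatives
-- being equal when they are Turing equivalent.
TuringDegrees : Poset (lsuc 0ℓ) 0ℓ 0ℓ
TuringDegrees = Interior.poset {R = _≤T_} ≤T-refl ≤T-trans

module Deg = Poset TuringDegrees

Degree : Set₁
Degree = Deg.Carrier

DegreeSet : (ℓ : Level) → Set (lsuc 0ℓ ⊔ lsuc ℓ)
DegreeSet ℓ = Σ (Pred Degree ℓ) (_Respects Deg._≈_)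

infix 4 _∈D_

_∈D_ : ∀ {ℓ} → Degree → DegreeSet ℓ → Set ℓ
d ∈D 𝒜 = d ∈ proj₁ 𝒜

record Ceer : Set₁ where
  field
    _∼_           : Rel ℕ 0ℓ
    isEquivalence : IsEquivalence _∼_
    isCE          : CERel _∼_

-- An infinite sequence of pairwise inequivalent elements.
InfinitelyManyClasses : Rel ℕ 0ℓ → Set
InfinitelyManyClasses R = ∃ λ (h : ℕ → ℕ) → Injective _≡_ R h

_≤[_]_ : Rel ℕ 0ℓ → Degree → Rel ℕ 0ℓ → Set
R ≤[ d ] S = ∃ λ (f : ℕ → ℕ) → (d -Computable f) × (∀ x y → R x y ⇔ S (f x) (f y))

≤[]-resp : (R S : Rel ℕ 0ℓ) → (λ d → R ≤[ d ] S) Respects Deg._≈_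
≤[]-resp R S d≈e (f , (c , c↓) , red) =
  f , (c [oracle≔ _ ] , λ x → ↓-subst (Deg.reflexive d≈e) (c↓ x)) , red

DgSp⇒ : Rel ℕ 0ℓ → Rel ℕ 0ℓ → DegreeSet 0ℓ
DgSp⇒ R S = (λ d → R ≤[ d ] S) , λ {d} {e} → ≤[]-resp R S {d} {e}

record _IsBasisOf_ {a b} (ℬ : DegreeSet b) (𝒜 : DegreeSet a) : Set (lsuc 0ℓ ⊔ a ⊔ b) where
  field
    incomparable : ∀ {c d} → c ∈D ℬ → d ∈D ℬ → ¬ (c Deg.≈ d) →
                   ¬ (c Deg.≤ d) × ¬ (d Deg.≤ c)
    generates    : ∀ d → d ∈D 𝒜 ⇔ (∃ λ b → b ∈D ℬ × b Deg.≤ d)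

{-# OPTIONS --safe #-}
module Submission where

-- Let W 1 and W 2 be the sets of inputs on which a universal partial function
-- halts with output zero, respectively positive output.  R collapses each of
-- the two sets to a point; S lives on two copies of ℕ, collapsing W 1 in one and
-- W 2 in the other.  A separator C of W 1 and W 2 reduces R to S by choosing the
-- copy of x according to whether x ∈ C.  Conversely, in a reduction f the classes
-- of f (W 1) and f (W 2) are either contained in different copies, or one of them
-- is a single point; so a separator is computable from f.  Hence the spectrum
-- consists of the degrees of separators and those above them.
--
-- Every separator C computes a separator X ≱ C.  For consider the pairs (X , Y)
-- of a separator X and a set Y that differs at n from the output of the n-th
-- program on n with oracle X.  They are the paths of a tree whose complement is
-- enumerable, so a search finds, for every string with exactly one child that
-- lies on a path, the other child.  The outcome of this search is a partial
-- computable function, and C knows a total extension of it: hence C computes a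
-- path (X , Y), and Y ≤ C is not computable from X.
--
-- So the spectrum has no minimal elements, whereas the elements of a basis are
-- minimal in the set that they generate.

open import Defs
open import Axiom.ExcludedMiddle using (ExcludedMiddle)
open import Data.Bool.Base using (Bool; true; false; not; if_then_else_)
open import Data.Bool.Properties using (¬-not)
open import Data.Fin.Base using (Fin; zero; suc; toℕ)
open import Data.Nat.Base
open import Data.Nat.GeneralisedArithmetic using (fold; iterate; iterate-is-fold)
open import Data.List.Base using (List; []; _∷_)
open import Data.Nat.Induction using (<-rec)
open import Data.Nat.Properties
open import Data.Product.Base using (∃; ∃₂; _×_; _,_; proj₁; proj₂)
open import Data.Sum.Base using (_⊎_; inj₁; inj₂; [_,_]′)
open import Data.Unit.Base using (⊤)
open import Data.Vec.Base using (Vec; []; _∷_; lookup)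
open import Data.Vec.Relation.Binary.Pointwise.Inductive using (Pointwise; []; _∷_)
open import Function.Bundles using (mk⇔; Equivalence)
open import Level using (0ℓ) renaming (suc to lsuc)
open import Relation.Binary.Definitions using (tri<; tri≈; tri>)
open import Relation.Binary.PropositionalEquality
  using (_≡_; _≢_; refl; sym; trans; cong; cong₂; subst; subst₂; module ≡-Reasoning)
open import Relation.Binary.Structures using (IsEquivalence)
open import Relation.Nullary.Decidable using (yes; no; does)
open import Relation.Nullary.Negation.Core using (¬_; contradiction)
open import Relation.Unary using (Pred; _∈_; _∉_; ∅)

private
  variable
    m n x y z v w : ℕ
    A : Pred ℕ 0ℓ

-- Programs

↓comp₁ : {f : Code 1} {g : Code n} {xs : Vec ℕ n} →
         A ⊢ g · xs ↓ v → A ⊢ f · v ∷ [] ↓ y → A ⊢ comp f (g ∷ []) · xs ↓ y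
↓comp₁ p q = ↓comp (p ∷ []) q

↓comp₂ : {f : Code 2} {g h : Code n} {xs : Vec ℕ n} →
         A ⊢ g · xs ↓ v → A ⊢ h · xs ↓ w → A ⊢ f · v ∷ w ∷ [] ↓ y →
         A ⊢ comp f (g ∷ h ∷ []) · xs ↓ y
↓comp₂ p q r = ↓comp (p ∷ q ∷ []) r

↓-resp : {c : Code n} {xs : Vec ℕ n} → y ≡ z → A ⊢ c · xs ↓ y → A ⊢ c · xs ↓ z
↓-resp refl p = p

mutual
  ↓-det : {c : Code n} {xs : Vec ℕ n} → A ⊢ c · xs ↓ y → A ⊢ c · xs ↓ z → y ≡ z
  ↓-det ↓zero          ↓zero           = refl
  ↓-det ↓suc           ↓suc            = refl
  ↓-det (↓proj i)      (↓proj .i)      = refl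
  ↓-det (↓oracle-∈ _)  (↓oracle-∈ _)   = refl
  ↓-det (↓oracle-∈ p)  (↓oracle-∉ q)   = contradiction p q
  ↓-det (↓oracle-∉ p)  (↓oracle-∈ q)   = contradiction q p
  ↓-det (↓oracle-∉ _)  (↓oracle-∉ _)   = refl
  ↓-det (↓comp ps p)   (↓comp qs q) with refl ← ↓-det* ps qs = ↓-det p q
  ↓-det (↓prec-zero p) (↓prec-zero q)  = ↓-det p q
  ↓-det (↓prec-suc p p′) (↓prec-suc q q′) with refl ← ↓-det p q = ↓-det p′ q′
  ↓-det {y = y} {z = z} (↓μ ps p) (↓μ qs q) with <-cmp y z
  ... | tri≈ _ y≡z _ = y≡z
  ... | tri< y<z _ _ = contradiction (↓-det p (proj₂ (qs _ y<z))) 0≢1+n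
  ... | tri> _ _ z<y = contradiction (↓-det q (proj₂ (ps _ z<y))) 0≢1+n

  ↓-det* : {gs : Vec (Code n) m} {xs : Vec ℕ n} {ys zs : Vec ℕ m} →
           Pointwise (λ g v → A ⊢ g · xs ↓ v) gs ys →
           Pointwise (λ g v → A ⊢ g · xs ↓ v) gs zs → ys ≡ zs
  ↓-det* []       []       = refl
  ↓-det* (p ∷ ps) (q ∷ qs) = cong₂ _∷_ (↓-det p q) (↓-det* ps qs)

least : (g : ℕ → ℕ) → ∀ s → g s ≡ 0 → ∃ λ y → g y ≡ 0 × ∀ i → i < y → g i ≢ 0
least g zero    eq = 0 , eq , λ _ ()
least g (suc s) eq with g 0 in eq₀
... | zero  = 0 , eq₀ , λ _ ()
... | suc k = let (y , eq′ , below) = least (λ i → g (suc i)) s eq in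
  suc y , eq′ , λ { zero _ p → 1+n≢0 (trans (sym eq₀) p) ; (suc i) (s≤s i<y) → below i i<y }

↓search : {f : Code (suc n)} {xs : Vec ℕ n} (g : ℕ → ℕ) →
          (∀ s → A ⊢ f · s ∷ xs ↓ g s) → ∀ s → g s ≡ 0 →
          ∃ λ y → g y ≡ 0 × A ⊢ μ f · xs ↓ y
↓search {A = A} {f = f} {xs = xs} g ↓g s eq =
  let (y , eq′ , below) = least g s eq
  in y , eq′ , ↓μ (λ i i<y → positive i (g i) (below i i<y) (↓g i)) (↓-resp eq′ (↓g y))
  where
  positive : ∀ i v → v ≢ 0 → A ⊢ f · i ∷ xs ↓ v → ∃ λ k → A ⊢ f · i ∷ xs ↓ suc k
  positive i zero    v≢0 p = contradiction refl v≢0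
  positive i (suc k) v≢0 p = k , p

constᶜ : ℕ → Code n
constᶜ zero    = zeroᶜ
constᶜ (suc k) = comp sucᶜ (constᶜ k ∷ [])

↓const : ∀ k {xs : Vec ℕ n} → A ⊢ constᶜ k · xs ↓ k
↓const zero    = ↓zero
↓const (suc k) = ↓comp₁ (↓const k) ↓suc

predᶜ : Code 1
predᶜ = prec zeroᶜ (proj zero)

↓pred : ∀ x → A ⊢ predᶜ · x ∷ [] ↓ pred x
↓pred zero    = ↓prec-zero ↓zero
↓pred (suc x) = ↓prec-suc (↓pred x) (↓proj zero)

addᶜ : Code 2
addᶜ = prec (proj zero) (comp sucᶜ (proj (suc zero) ∷ []))

↓add : ∀ x y → A ⊢ addᶜ · x ∷ y ∷ [] ↓ x + y
↓add zero    y = ↓prec-zero (↓proj zero)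
↓add (suc x) y = ↓prec-suc (↓add x y) (↓comp₁ (↓proj (suc zero)) ↓suc)

monusᶜ : Code 2
monusᶜ = prec (proj zero) (comp predᶜ (proj (suc zero) ∷ []))

↓monus : ∀ x y → A ⊢ monusᶜ · x ∷ y ∷ [] ↓ y ∸ x
↓monus zero    y = ↓prec-zero (↓proj zero)
↓monus (suc x) y = ↓prec-suc (↓monus x y)
  (↓comp₁ (↓proj (suc zero)) (↓-resp (pred[m∸n]≡m∸[1+n] y x) (↓pred _)))

-- Cantor pairing

△ : ℕ → ℕ
△ zero    = 0
△ (suc w) = suc w + △ w

△-mono-≤ : x ≤ y → △ x ≤ △ y
△-mono-≤ z≤n     = z≤n
△-mono-≤ (s≤s p) = +-mono-≤ (s≤s p) (△-mono-≤ p)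

n≤△n : ∀ n → n ≤ △ n
n≤△n zero    = z≤n
n≤△n (suc n) = m≤m+n (suc n) (△ n)

△ᶜ : Code 1
△ᶜ = prec zeroᶜ (comp addᶜ (comp sucᶜ (proj zero ∷ []) ∷ proj (suc zero) ∷ []))

↓△ : ∀ x → A ⊢ △ᶜ · x ∷ [] ↓ △ x
↓△ zero    = ↓prec-zero ↓zero
↓△ (suc x) = ↓prec-suc (↓△ x)
  (↓comp₂ (↓comp₁ (↓proj zero) ↓suc) (↓proj (suc zero)) (↓add (suc x) (△ x)))

pairᶜ : Code 2
pairᶜ = comp addᶜ (comp △ᶜ (addᶜ ∷ []) ∷ proj zero ∷ [])

-- The least w with n < △ (suc w), which is x + y for n = pair x y.
diagᶜ : Code 1
diagᶜ = μ (comp monusᶜ (comp △ᶜ (comp sucᶜ (proj zero ∷ []) ∷ []) ∷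
                        comp sucᶜ (proj (suc zero) ∷ []) ∷ []))

fstᶜ : Code 1
fstᶜ = comp monusᶜ (comp △ᶜ (diagᶜ ∷ []) ∷ proj zero ∷ [])

sndᶜ : Code 1
sndᶜ = comp monusᶜ (fstᶜ ∷ diagᶜ ∷ [])

opaque
  pair : ℕ → ℕ → ℕ
  pair x y = △ (x + y) + x

  pair-00 : pair 0 0 ≡ 0
  pair-00 = refl

  pair-01 : pair 0 1 ≡ 1
  pair-01 = refl

  pair-≥ : ∀ x y → x + y ≤ pair x y
  pair-≥ x y = ≤-trans (n≤△n (x + y)) (m≤m+n _ x)

  pair-surjective : ∀ n → ∃₂ λ x y → pair x y ≡ n
  pair-surjective zero = 0 , 0 , refl
  pair-surjective (suc n) with pair-surjective n
  ... | x , suc y , refl = suc x , y , (begin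
    suc x + y + △ (x + y) + suc x   ≡⟨ +-suc _ x ⟩
    suc (△ (suc x + y) + x)         ≡⟨ cong (λ k → suc (△ k + x)) (+-suc x y) ⟨
    suc (△ (x + suc y) + x)         ∎)
    where open ≡-Reasoning
  ... | x , zero  , refl = 0 , suc x , (begin
    △ (suc x) + 0        ≡⟨ +-identityʳ _ ⟩
    suc (x + △ x)        ≡⟨ cong suc (+-comm x (△ x)) ⟩
    suc (△ x + x)        ≡⟨ cong (λ k → suc (△ k + x)) (+-identityʳ x) ⟨
    suc (△ (x + 0) + x)  ∎)
    where open ≡-Reasoning

  ↓pair : ∀ x y → A ⊢ pairᶜ · x ∷ y ∷ [] ↓ pair x y
  ↓pair x y = ↓comp₂ (↓comp₁ (↓add x y) (↓△ _)) (↓proj zero) (↓add _ x)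

  ↓diag : ∀ x y → A ⊢ diagᶜ · pair x y ∷ [] ↓ x + y
  ↓diag {A = A} x y = ↓μ
    (λ w w<x+y → pair x y ∸ △ (suc w) ,
      ↓-resp
        (+-∸-assoc 1 (≤-trans (△-mono-≤ w<x+y) (m≤m+n _ x))) (search w))
    (↓-resp (m≤n⇒m∸n≡0 pair<△) (search (x + y)))
    where
    search : ∀ w → A ⊢ comp monusᶜ (comp △ᶜ (comp sucᶜ (proj zero ∷ []) ∷ []) ∷
                                    comp sucᶜ (proj (suc zero) ∷ []) ∷ [])
                     · w ∷ pair x y ∷ [] ↓ suc (pair x y) ∸ △ (suc w)
    search w = ↓comp₂ (↓comp₁ (↓comp₁ (↓proj zero) ↓suc) (↓△ _))
                      (↓comp₁ (↓proj (suc zero)) ↓suc) (↓monus _ _)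

    pair<△ : pair x y < △ (suc (x + y))
    pair<△ = s≤s (≤-trans (≤-reflexive (+-comm _ x)) (+-monoˡ-≤ _ (m≤m+n x y)))

  ↓fst : ∀ x y → A ⊢ fstᶜ · pair x y ∷ [] ↓ x
  ↓fst x y = ↓-resp (m+n∸m≡n (△ (x + y)) x)
    (↓comp₂ (↓comp₁ (↓diag x y) (↓△ _)) (↓proj zero) (↓monus _ _))

  ↓snd : ∀ x y → A ⊢ sndᶜ · pair x y ∷ [] ↓ y
  ↓snd x y = ↓-resp (m+n∸m≡n x y)
    (↓comp₂ (↓fst x y) (↓diag x y) (↓monus _ _))

pair-injective : ∀ {x y x′ y′} → pair x y ≡ pair x′ y′ → x ≡ x′ × y ≡ y′
pair-injective {x} {y} {x′} {y′} eq =
  ↓-det {A = ∅} (↓fst x y) (subst (λ n → ∅ ⊢ fstᶜ · n ∷ [] ↓ x′) (sym eq) (↓fst x′ y′)) ,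
  ↓-det {A = ∅} (↓snd x y) (subst (λ n → ∅ ⊢ sndᶜ · n ∷ [] ↓ y′) (sym eq) (↓snd x′ y′))

-- Binary trees as data

infixr 5 _∙_

data Tree : Set where
  nat : ℕ → Tree
  _∙_ : Tree → Tree → Tree

enc : Tree → ℕ
enc (nat n) = pair 0 n
enc (a ∙ b) = pair (suc (enc a)) (enc b)

enc-injective : ∀ d d′ → enc d ≡ enc d′ → d ≡ d′
enc-injective (nat m) (nat n)   eq = cong nat (proj₂ (pair-injective eq))
enc-injective (nat _) (_ ∙ _)   eq = contradiction (proj₁ (pair-injective eq)) 0≢1+n
enc-injective (_ ∙ _) (nat _)   eq = contradiction (proj₁ (pair-injective eq)) 1+n≢0
enc-injective (a ∙ b) (a′ ∙ b′) eq = let (p , q) = pair-injective eq in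
  cong₂ _∙_ (enc-injective a a′ (suc-injective p)) (enc-injective b b′ q)

opaque
  enc-surjective : ∀ n → ∃ λ d → enc d ≡ n
  enc-surjective = <-rec _ λ n rec → by-pair n rec (pair-surjective n)
    where
    by-pair : ∀ n → (∀ {m} → m < n → ∃ λ d → enc d ≡ m) →
              (∃₂ λ x y → pair x y ≡ n) → ∃ λ d → enc d ≡ n
    by-pair n rec (zero  , y , eq) = nat y , eq
    by-pair n rec (suc x , y , refl) =
      let (a , p) = rec (≤-trans (s≤s (m≤m+n x y)) (pair-≥ (suc x) y))
          (b , q) = rec (≤-trans (s≤s (m≤n+m y x)) (pair-≥ (suc x) y))
      in a ∙ b , cong₂ (λ i j → pair (suc i) j) p q

dec : ℕ → Tree
dec n = proj₁ (enc-surjective n)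

enc-dec : ∀ n → enc (dec n) ≡ n
enc-dec n = proj₂ (enc-surjective n)

dec-enc : ∀ d → dec (enc d) ≡ d
dec-enc d = enc-injective _ d (enc-dec (enc d))

enc-≥ : ∀ a b → enc b ≤ enc (a ∙ b)
enc-≥ a b = ≤-trans (m≤n+m _ _) (pair-≥ (suc (enc a)) (enc b))

enc≡0⇒ : ∀ d → enc d ≡ 0 → d ≡ nat 0
enc≡0⇒ d eq = enc-injective d (nat 0) (trans eq (sym pair-00))

-- On inner nodes val is the second component of the code as well, so that
-- programs need no case distinction.
val : Tree → ℕ
val (nat n) = n
val (_ ∙ b) = enc b

-- Total functions on trees and their programs

infixr 9 _⊙_
infixr 4 _,ᵗ_

-- Programs are written as terms because `⟦_⟧` gives their values directly and `code` compiles them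
-- once and for all. Facts about the machine below then hold by computation instead of by
-- derivations.
data Term : Set where
  idᵗ hd tl quo sc pd : Term
  cst  : Tree → Term
  _⊙_  : Term → Term → Term
  _,ᵗ_ : Term → Term → Term
  ifz  : Term → Term → Term → Term
  iter : Term → Term

if0 : {B : Set} → Tree → B → B → B
if0 (nat zero)    t e = t
if0 (nat (suc _)) t e = e
if0 (_ ∙ _)       t e = e

zero? : ∀ d → d ≡ nat 0 ⊎ d ≢ nat 0
zero? (nat zero)    = inj₁ refl
zero? (nat (suc _)) = inj₂ λ ()
zero? (_ ∙ _)       = inj₂ λ ()

if0-zero : ∀ {B : Set} {d} {t e : B} → d ≡ nat 0 → if0 d t e ≡ t
if0-zero refl = refl

if0-nonzero : ∀ {B : Set} {d} {t e : B} → d ≢ nat 0 → if0 d t e ≡ e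
if0-nonzero {d = nat zero}    ≢0 = contradiction refl ≢0
if0-nonzero {d = nat (suc _)} ≢0 = refl
if0-nonzero {d = _ ∙ _}       ≢0 = refl

head tail : Tree → Tree
head (nat _) = nat 0
head (a ∙ _) = a
-- On the code of this leaf `sndᶜ` returns `n`, which is the code of `dec n`.
tail (nat n) = dec n
tail (_ ∙ b) = b

⟦_⟧ : Term → Tree → Tree
⟦ idᵗ ⟧ d       = d
⟦ hd ⟧ d        = head d
⟦ tl ⟧ d        = tail d
⟦ quo ⟧ d       = nat (enc d)
⟦ sc ⟧ d        = nat (suc (val d))
⟦ pd ⟧ d        = nat (pred (val d))
⟦ cst c ⟧ d     = c
⟦ f ⊙ g ⟧ d     = ⟦ f ⟧ (⟦ g ⟧ d)
⟦ f ,ᵗ g ⟧ d    = ⟦ f ⟧ d ∙ ⟦ g ⟧ d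
⟦ ifz f g h ⟧ d = if0 (⟦ f ⟧ d) (⟦ g ⟧ d) (⟦ h ⟧ d)
⟦ iter f ⟧ d    = fold (tail d) ⟦ f ⟧ (val (head d))

natᶜ : Code 1
natᶜ = comp pairᶜ (zeroᶜ ∷ proj zero ∷ [])

↓nat : ∀ n → A ⊢ natᶜ · n ∷ [] ↓ enc (nat n)
↓nat n = ↓comp₂ ↓zero (↓proj zero) (↓pair 0 n)

nodeᶜ : Code 2
nodeᶜ = comp pairᶜ (comp sucᶜ (proj zero ∷ []) ∷ proj (suc zero) ∷ [])

↓node : ∀ a b → A ⊢ nodeᶜ · enc a ∷ enc b ∷ [] ↓ enc (a ∙ b)
↓node a b = ↓comp₂ (↓comp₁ (↓proj zero) ↓suc) (↓proj (suc zero)) (↓pair _ _)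

↓node-dec : ∀ n x → A ⊢ nodeᶜ · enc (nat n) ∷ x ∷ [] ↓ enc (nat n ∙ dec x)
↓node-dec n x = ↓comp₂ (↓comp₁ (↓proj zero) ↓suc) (↓proj (suc zero))
  (↓-resp (cong (pair _) (sym (enc-dec x))) (↓pair _ _))

hdᶜ : Code 1
hdᶜ = comp predᶜ (fstᶜ ∷ [])

↓hd : ∀ d → A ⊢ hdᶜ · enc d ∷ [] ↓ enc (head d)
↓hd (nat n) = ↓-resp (sym pair-00) (↓comp₁ (↓fst 0 n) (↓pred 0))
↓hd (a ∙ b) = ↓comp₁ (↓fst (suc (enc a)) (enc b)) (↓pred _)

↓tl : ∀ d → A ⊢ sndᶜ · enc d ∷ [] ↓ enc (tail d)
↓tl (nat n) = ↓-resp (sym (enc-dec n)) (↓snd 0 n)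
↓tl (a ∙ b) = ↓snd (suc (enc a)) (enc b)

↓val : ∀ d → A ⊢ sndᶜ · enc d ∷ [] ↓ val d
↓val (nat n) = ↓snd 0 n
↓val (a ∙ b) = ↓snd (suc (enc a)) (enc b)

-- Since `nat 0` is the tree with code 0, primitive recursion on the code of the test selects the
-- branch. The base case `g` is evaluated either way, which is harmless for total terms.
ifzᶜ : Code 1 → Code 1 → Code 1 → Code 1
ifzᶜ f g h = comp (prec g (comp h (proj (suc (suc zero)) ∷ []))) (f ∷ proj zero ∷ [])

iterᶜ : Code 1 → Code 1
iterᶜ f = comp (prec (proj zero) (comp f (proj (suc zero) ∷ [])))
               (comp sndᶜ (hdᶜ ∷ []) ∷ sndᶜ ∷ [])

↓ifz : ∀ {f g h} d e t s →
       A ⊢ f · d ∷ [] ↓ enc t → A ⊢ g · d ∷ [] ↓ enc e → A ⊢ h · d ∷ [] ↓ enc s →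
       A ⊢ ifzᶜ f g h · d ∷ [] ↓ enc (if0 t e s)
↓ifz {A = A} {f} {g} {h} d e t s p q r = ↓comp₂ p (↓proj zero) (branch t)
  where
  G : Code 3
  G = comp h (proj (suc (suc zero)) ∷ [])
  rec : ∀ n → ∃ λ v → A ⊢ prec g G · n ∷ d ∷ [] ↓ v
  rec zero    = _ , ↓prec-zero q
  rec (suc n) = _ , ↓prec-suc (proj₂ (rec n)) (↓comp₁ (↓proj (suc (suc zero))) r)
  rec-suc : ∀ {n} k → n ≡ suc k → A ⊢ prec g G · n ∷ d ∷ [] ↓ enc s
  rec-suc k refl = ↓prec-suc (proj₂ (rec k)) (↓comp₁ (↓proj (suc (suc zero))) r)
  positive : ∀ a → enc a ≢ 0 → A ⊢ prec g G · enc a ∷ d ∷ [] ↓ enc s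
  positive a a≢0 with enc a in eq
  ... | zero  = contradiction refl a≢0
  ... | suc k = rec-suc k refl
  branch : ∀ t → A ⊢ prec g G · enc t ∷ d ∷ [] ↓ enc (if0 t e s)
  branch (nat zero)    = subst (λ n → A ⊢ prec g G · n ∷ d ∷ [] ↓ enc e) (sym pair-00) (↓prec-zero q)
  branch (nat (suc n)) = positive (nat (suc n)) λ eq → 1+n≢0 (proj₂ (pair-injective (trans eq (sym pair-00))))
  branch (a ∙ b)       = positive (a ∙ b) λ eq → 1+n≢0 (proj₁ (pair-injective (trans eq (sym pair-00))))

code : Term → Code 1
code idᵗ         = proj zero
code hd          = hdᶜ
code tl          = sndᶜ
code quo         = natᶜ
code sc          = comp natᶜ (comp sucᶜ (sndᶜ ∷ []) ∷ [])
code pd          = comp natᶜ (comp predᶜ (sndᶜ ∷ []) ∷ [])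
code (cst d)     = constᶜ (enc d)
code (f ⊙ g)     = comp (code f) (code g ∷ [])
code (f ,ᵗ g)    = comp nodeᶜ (code f ∷ code g ∷ [])
code (ifz f g h) = ifzᶜ (code f) (code g) (code h)
code (iter f)    = iterᶜ (code f)

↓code : ∀ t d → A ⊢ code t · enc d ∷ [] ↓ enc (⟦ t ⟧ d)
↓code idᵗ         d = ↓proj zero
↓code hd          d = ↓hd d
↓code tl          d = ↓tl d
↓code quo         d = ↓nat (enc d)
↓code sc          d = ↓comp₁ (↓comp₁ (↓val d) ↓suc) (↓nat _)
↓code pd          d = ↓comp₁ (↓comp₁ (↓val d) (↓pred _)) (↓nat _)
↓code (cst c)     d = ↓const (enc c)
↓code (f ⊙ g)     d = ↓comp₁ (↓code g d) (↓code f _)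
↓code (f ,ᵗ g)    d = ↓comp₂ (↓code f d) (↓code g d) (↓node (⟦ f ⟧ d) (⟦ g ⟧ d))
↓code (ifz f g h) d = ↓ifz (enc d) (⟦ g ⟧ d) (⟦ f ⟧ d) (⟦ h ⟧ d) (↓code f d) (↓code g d) (↓code h d)
↓code {A = A} (iter f) d = ↓comp₂ (↓comp₁ (↓hd d) (↓val (head d))) (↓tl d) (loop (val (head d)))
  where
  loop : ∀ n → A ⊢ _ · n ∷ enc (tail d) ∷ [] ↓ enc (fold (tail d) ⟦ f ⟧ n)
  loop zero    = ↓prec-zero (↓proj zero)
  loop (suc n) = ↓prec-suc (loop n) (↓comp₁ (↓proj (suc zero)) (↓code f _))

↓code-dec : ∀ t x → A ⊢ code t · x ∷ [] ↓ enc (⟦ t ⟧ (dec x))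
↓code-dec {A = A} t x = subst (λ k → A ⊢ code t · k ∷ [] ↓ enc (⟦ t ⟧ (dec x))) (enc-dec x) (↓code t (dec x))

-- An abstract machine running programs with a finite string as oracle

-- States of a stack machine: `ev` evaluates a program on arguments, `rt` hands a value back to the
-- stack `K` of pending frames. With the empty stack `nat 0`, `rt` is the halted state.
ev : Tree → Tree → Tree → Tree
ev c xs K = nat 0 ∙ c ∙ xs ∙ K

rt : Tree → Tree → Tree
rt v K = nat 1 ∙ v ∙ K

mutual
  ⌜_⌝ : Code n → Tree
  ⌜ zeroᶜ ⌝     = nat 0 ∙ nat 0
  ⌜ sucᶜ ⌝      = nat 1 ∙ nat 0
  ⌜ proj i ⌝    = nat 2 ∙ nat (toℕ i)
  ⌜ oracle ⌝    = nat 3 ∙ nat 0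
  ⌜ comp f gs ⌝ = nat 4 ∙ ⌜ f ⌝ ∙ ⌜ gs ⌝*
  ⌜ prec f g ⌝  = nat 5 ∙ ⌜ f ⌝ ∙ ⌜ g ⌝
  ⌜ μ f ⌝       = nat 6 ∙ ⌜ f ⌝

  ⌜_⌝* : Vec (Code n) m → Tree
  ⌜ [] ⌝*     = nat 7 ∙ nat 0
  ⌜ g ∷ gs ⌝* = nat 8 ∙ ⌜ g ⌝ ∙ ⌜ gs ⌝*

⌜_⌝ᵛ : Vec ℕ n → Tree
⌜ [] ⌝ᵛ     = nat 0
⌜ x ∷ xs ⌝ᵛ = nat x ∙ ⌜ xs ⌝ᵛ

0ᵗ 1ᵗ 2ᵗ 3ᵗ 4ᵗ : Term
0ᵗ = cst (nat 0)
1ᵗ = cst (nat 1)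
2ᵗ = cst (nat 2)
3ᵗ = cst (nat 3)
4ᵗ = cst (nat 4)

evᵗ : Term → Term → Term → Term
evᵗ c xs K = 0ᵗ ,ᵗ c ,ᵗ xs ,ᵗ K

rtᵗ : Term → Term → Term
rtᵗ v K = 1ᵗ ,ᵗ v ,ᵗ K

switch : Term → List Term → Term → Term
switch t []       e = e
switch t (b ∷ bs) e = ifz t b (switch (pd ⊙ t) bs e)

-- The cases follow the tags of `⌜_⌝` and `⌜_⌝*`. An oracle call, tag 3, is left to `stepᵗ`; a
-- numeral that is no tag leaves the state as it is.
evalᵗ : Term
evalᵗ = switch (hd ⊙ c)
  ( rtᵗ 0ᵗ K
  ∷ rtᵗ (sc ⊙ hd ⊙ xs) K
  ∷ rtᵗ (hd ⊙ iter tl ⊙ (tl ⊙ c ,ᵗ xs)) K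
  ∷ idᵗ
  ∷ evᵗ c₂ xs ((0ᵗ ,ᵗ c₁) ,ᵗ K)
  ∷ ifz (hd ⊙ xs)
      (evᵗ c₁ (tl ⊙ xs) K)
      (evᵗ c (pd ⊙ hd ⊙ xs ,ᵗ tl ⊙ xs) ((3ᵗ ,ᵗ c₂ ,ᵗ pd ⊙ hd ⊙ xs ,ᵗ tl ⊙ xs) ,ᵗ K))
  ∷ evᵗ (tl ⊙ c) (0ᵗ ,ᵗ xs) ((4ᵗ ,ᵗ tl ⊙ c ,ᵗ 0ᵗ ,ᵗ xs) ,ᵗ K)
  ∷ rtᵗ 0ᵗ K
  ∷ evᵗ c₁ xs ((1ᵗ ,ᵗ c₂ ,ᵗ xs) ,ᵗ K)
  ∷ []) idᵗ
  where
  c xs K c₁ c₂ : Term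
  c  = hd ⊙ tl
  xs = hd ⊙ tl ⊙ tl
  K  = tl ⊙ tl ⊙ tl
  c₁ = hd ⊙ tl ⊙ c
  c₂ = tl ⊙ tl ⊙ c

-- The frames 0 ∙ f, 1 ∙ gs ∙ xs, 2 ∙ w, 3 ∙ g ∙ x ∙ xs and 4 ∙ f ∙ i ∙ xs wait for
-- the arguments of f, the head of a list, its tail, the previous value of a
-- primitive recursion, and the value at i of a function being minimised.
returnᵗ : Term
returnᵗ = switch (hd ⊙ F)
  ( evᵗ (tl ⊙ F) r K
  ∷ evᵗ (hd ⊙ tl ⊙ F) (tl ⊙ tl ⊙ F) ((2ᵗ ,ᵗ r) ,ᵗ K)
  ∷ rtᵗ (tl ⊙ F ,ᵗ r) K
  ∷ evᵗ (hd ⊙ tl ⊙ F) (i ,ᵗ r ,ᵗ xs) K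
  ∷ ifz r (rtᵗ i K)
      (evᵗ f (sc ⊙ i ,ᵗ xs) ((4ᵗ ,ᵗ f ,ᵗ sc ⊙ i ,ᵗ xs) ,ᵗ K))
  ∷ []) idᵗ
  where
  r F K f i xs : Term
  r  = hd ⊙ tl
  F  = hd ⊙ tl ⊙ tl
  K  = tl ⊙ tl ⊙ tl
  f  = hd ⊙ tl ⊙ F
  i  = hd ⊙ tl ⊙ tl ⊙ F
  xs = tl ⊙ tl ⊙ tl ⊙ F

plainᵗ : Term
plainᵗ = ifz hd evalᵗ (ifz (tl ⊙ tl) idᵗ returnᵗ)

-- Finite strings as oracles

asksᵗ : Term
asksᵗ = ifz hd (switch (hd ⊙ hd ⊙ tl) (1ᵗ ∷ 1ᵗ ∷ 1ᵗ ∷ 0ᵗ ∷ []) 1ᵗ) 1ᵗ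

-- Shifted by one so that `nat 0` can mean that no value is available. `outᵗ` and `verdict` code
-- zero and positive outputs in the same way, so that results and bits can be compared.
bit : Bool → Tree
bit false = nat 1
bit true  = nat 2

bits : (ℕ → Bool) → ℕ → Tree
bits Z zero    = nat 0
bits Z (suc L) = bit (Z L) ∙ bits Z L

-- Strings are stored with their length and in reverse order.
prefix : (ℕ → Bool) → ℕ → Tree
prefix Z L = nat L ∙ bits Z L

-- Position 2m, respectively 2m + 1, of a string; 0 if the string is too short.
opaque
  evenᵗ oddᵗ : Term
  evenᵗ = hd ⊙ iter tl ⊙ (iter pd ⊙ (tl ,ᵗ iter pd ⊙ (tl ,ᵗ hd ⊙ hd)) ,ᵗ 0ᵗ ,ᵗ tl ⊙ hd)
  oddᵗ  = hd ⊙ iter tl ⊙ (pd ⊙ iter pd ⊙ (tl ,ᵗ iter pd ⊙ (tl ,ᵗ hd ⊙ hd)) ,ᵗ 0ᵗ ,ᵗ tl ⊙ hd)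

-- Queries read even positions only: a string is a piece of a join whose odd half stays hidden from
-- the machine. `pd ⊙ sc` turns the argument into a leaf.
queryᵗ : Term
queryᵗ = evenᵗ ⊙ (hd ,ᵗ pd ⊙ sc ⊙ hd ⊙ hd ⊙ tl ⊙ tl ⊙ tl)

-- A query beyond the end of the string blocks the machine.
stepᵗ : Term
stepᵗ = ifz (asksᵗ ⊙ tl)
  (ifz queryᵗ tl (rtᵗ (pd ⊙ queryᵗ) (tl ⊙ tl ⊙ tl ⊙ tl)))
  (plainᵗ ⊙ tl)

outᵗ : Term
outᵗ = ifz hd 0ᵗ (ifz (tl ⊙ tl) (ifz (hd ⊙ tl) 1ᵗ 2ᵗ) 0ᵗ)

step : Tree → Tree → Tree
step ρ st = ⟦ stepᵗ ⟧ (ρ ∙ st)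

fold-pd : ∀ m n → fold (nat m) ⟦ pd ⟧ n ≡ nat (m ∸ n)
fold-pd m zero    = refl
fold-pd m (suc n) rewrite fold-pd m n = cong nat (pred[m∸n]≡m∸[1+n] m n)

fold-suc : ∀ {B : Set} (z : B) s n → fold z s (suc n) ≡ fold (s z) s n
fold-suc z s zero    = refl
fold-suc z s (suc n) = cong s (fold-suc z s n)

-- With the latest bit first, position `i` comes to the front after `L ∸ i` removals, the extra
-- entry `d` included. If the string is too short nothing is removed, and the `nat 0` that `evenᵗ`
-- and `oddᵗ` put for `d` marks the missing bit.
drop-bits : ∀ Z L i d → i < L → head (fold (d ∙ bits Z L) tail (L ∸ i)) ≡ bit (Z i)
drop-bits Z (suc L) i d (s≤s i≤L)
  rewrite +-∸-assoc 1 i≤L | fold-suc (d ∙ bits Z (suc L)) tail (L ∸ i)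
  with m≤n⇒m<n∨m≡n i≤L
... | inj₁ i<L  = drop-bits Z L i _ i<L
... | inj₂ refl rewrite n∸n≡0 L = refl

even-index : ∀ L m → fold (fold (nat L) ⟦ pd ⟧ m) ⟦ pd ⟧ m ≡ nat (L ∸ (m + m))
even-index L m rewrite fold-pd L m | fold-pd (L ∸ m) m = cong nat (∸-+-assoc L m m)

opaque
  unfolding evenᵗ oddᵗ

  even-short : ∀ Z L m → L ≤ m + m → ⟦ evenᵗ ⟧ (prefix Z L ∙ nat m) ≡ nat 0
  even-short Z L m p rewrite even-index L m | m≤n⇒m∸n≡0 p = refl

  even-bit : ∀ Z L m → m + m < L → ⟦ evenᵗ ⟧ (prefix Z L ∙ nat m) ≡ bit (Z (m + m))
  even-bit Z L m p rewrite even-index L m = drop-bits Z L (m + m) (nat 0) p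

  odd-short : ∀ Z L m → L ≤ suc (m + m) → ⟦ oddᵗ ⟧ (prefix Z L ∙ nat m) ≡ nat 0
  odd-short Z L m p rewrite even-index L m | pred[m∸n]≡m∸[1+n] L (m + m) | m≤n⇒m∸n≡0 p = refl

  odd-bit : ∀ Z L m → suc (m + m) < L → ⟦ oddᵗ ⟧ (prefix Z L ∙ nat m) ≡ bit (Z (suc (m + m)))
  odd-bit Z L m p rewrite even-index L m | pred[m∸n]≡m∸[1+n] L (m + m) =
    drop-bits Z L (suc (m + m)) (nat 0) p

infix 4 _⊑_

-- Even positions are all that a computation can see, so strings with different odd halves may be
-- exchanged.
_⊑_ : Tree → Tree → Set
ρ ⊑ ρ′ = ∀ m → ⟦ evenᵗ ⟧ (ρ ∙ nat m) ≡ nat 0 ⊎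
               ⟦ evenᵗ ⟧ (ρ ∙ nat m) ≡ ⟦ evenᵗ ⟧ (ρ′ ∙ nat m)

prefix-⊑ : ∀ {Z Z′ L L′} → (∀ m → Z (m + m) ≡ Z′ (m + m)) → L ≤ L′ → prefix Z L ⊑ prefix Z′ L′
prefix-⊑ {Z} {Z′} {L} {L′} Z≈Z′ L≤L′ m with m + m <? L
... | no ≮L  = inj₁ (even-short Z L m (≮⇒≥ ≮L))
... | yes <L = inj₂ (trans (even-bit Z L m <L)
    (trans (cong bit (Z≈Z′ m)) (sym (even-bit Z′ L′ m (≤-trans <L L≤L′)))))

step-⊑ : ∀ ρ ρ′ → ρ ⊑ ρ′ → ∀ st → step ρ st ≡ st ⊎ step ρ st ≡ step ρ′ st
step-⊑ ρ ρ′ ρ⊑ρ′ st with ⟦ asksᵗ ⟧ st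
... | nat (suc _) = inj₂ refl
... | _ ∙ _       = inj₂ refl
... | nat zero with ρ⊑ρ′ (val (head (head (tail (tail st)))))
...   | inj₁ eq rewrite eq = inj₁ refl
...   | inj₂ eq rewrite eq = inj₂ refl

step-halted : ∀ ρ st → ⟦ outᵗ ⟧ st ≢ nat 0 → step ρ st ≡ st
step-halted ρ st out≢0 with head st
... | nat zero = contradiction refl out≢0
... | nat (suc _) with tail (tail st)
...   | nat zero    = refl
...   | nat (suc _) = contradiction refl out≢0
...   | _ ∙ _       = contradiction refl out≢0
step-halted ρ st out≢0 | _ ∙ _ with tail (tail st)
...   | nat zero    = refl
...   | nat (suc _) = contradiction refl out≢0
...   | _ ∙ _       = contradiction refl out≢0

run : Tree → Tree → ℕ → Tree
run ρ = iterate (step ρ)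

iterate-fixed : ∀ {B : Set} {f : B → B} {b} → f b ≡ b → ∀ n → iterate f b n ≡ b
iterate-fixed         eq zero    = refl
iterate-fixed {f = f} eq (suc n) = trans (cong (λ b → iterate f b n) eq) (iterate-fixed eq n)

run-⊑ : ∀ ρ ρ′ → ρ ⊑ ρ′ → ∀ st {s s′} → s ≤ s′ → ⟦ outᵗ ⟧ (run ρ st s) ≢ nat 0 →
        ⟦ outᵗ ⟧ (run ρ′ st s′) ≡ ⟦ outᵗ ⟧ (run ρ st s)
run-⊑ ρ ρ′ ρ⊑ρ′ st {s′ = s′} z≤n out≢0 =
  cong ⟦ outᵗ ⟧ (iterate-fixed (step-halted ρ′ st out≢0) s′)
run-⊑ ρ ρ′ ρ⊑ρ′ st {suc s} {suc s′} (s≤s s≤s′) out≢0 with step-⊑ ρ ρ′ ρ⊑ρ′ st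
-- A blocked query wastes this step of `ρ`; it is dropped, while `ρ′` keeps its whole budget.
... | inj₁ stuck = trans
  (run-⊑ ρ ρ′ ρ⊑ρ′ st (m≤n⇒m≤1+n s≤s′) (λ ≡0 → out≢0 (trans (cong (outputs ρ s) stuck) ≡0)))
  (sym (cong (outputs ρ s) stuck))
  where
  outputs : Tree → ℕ → Tree → Tree
  outputs ρ s t = ⟦ outᵗ ⟧ (run ρ t s)
... | inj₂ same = trans
  (cong (λ t → ⟦ outᵗ ⟧ (run ρ′ t s′)) (sym same))
  (run-⊑ ρ ρ′ ρ⊑ρ′ (step ρ st) s≤s′ out≢0)

-- Correctness of the machine on convergent computations

data Reach (ρ : Tree) : Tree → Tree → Set where
  stop : ∀ {st} → Reach ρ st st
  next : ∀ {st st′} → Reach ρ (step ρ st) st′ → Reach ρ st st′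

infixr 5 _▷_

_▷_ : ∀ {ρ s t u} → Reach ρ s t → Reach ρ t u → Reach ρ s u
stop   ▷ q = q
next p ▷ q = next (p ▷ q)

Reach⇒run : ∀ {ρ s t} → Reach ρ s t → ∃ λ n → run ρ s n ≡ t
Reach⇒run stop     = 0 , refl
Reach⇒run (next p) = let (n , eq) = Reach⇒run p in suc n , eq

Eventually : (ℕ → Set) → Set
Eventually P = ∃ λ N → ∀ M → N ≤ M → P M

eventually₂ : {P Q : ℕ → Set} → Eventually P → Eventually Q → Eventually λ M → P M × Q M
eventually₂ (N , p) (N′ , q) = N ⊔ N′ , λ M le →
  p M (m⊔n≤o⇒m≤o N N′ le) , q M (m⊔n≤o⇒n≤o N N′ le)

eventually-< : {P : ℕ → ℕ → Set} → ∀ y → (∀ i → i < y → Eventually (P i)) →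
               Eventually λ M → ∀ i → i < y → P i M
eventually-< zero    _ = 0 , λ _ _ _ ()
eventually-< {P} (suc y) ps =
  let (N , r) = eventually₂ (ps y ≤-refl) (eventually-< y λ i i<y → ps i (m≤n⇒m≤1+n i<y))
  in N , λ M le i i≤y → let (p , q) = r M le in
       [ q i , (λ { refl → p }) ]′ (m≤n⇒m<n∨m≡n (s≤s⁻¹ i≤y))

lookup-list : (xs : Vec ℕ n) (i : Fin n) → head (fold ⌜ xs ⌝ᵛ tail (toℕ i)) ≡ nat (lookup xs i)
lookup-list (x ∷ xs) zero    = refl
lookup-list (x ∷ xs) (suc i) =
  trans (cong head (fold-suc ⌜ x ∷ xs ⌝ᵛ tail (toℕ i))) (lookup-list xs i)

Returns : Tree → Tree → Tree → Tree → Set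
Returns ρ c xs v = ∀ K → Reach ρ (ev c xs K) (rt v K)

search-loop : ∀ {ρ f xs y} → (∀ i → i < y → ∃ λ k → Returns ρ f (nat i ∙ xs) (nat (suc k))) →
              Returns ρ f (nat y ∙ xs) (nat 0) →
              ∀ K j {i} → i + j ≡ y →
              Reach ρ (ev f (nat i ∙ xs) ((nat 4 ∙ f ∙ nat i ∙ xs) ∙ K)) (rt (nat y) K)
search-loop ps p K zero {i} eq with refl ← trans (sym (+-identityʳ i)) eq = p _ ▷ next stop
search-loop ps p K (suc j) {i} eq =
  let (k , q) = ps i (≤-trans (m<m+n i z<s) (≤-reflexive eq))
  in q _ ▷ next (search-loop ps p K j (trans (sym (+-suc i j)) eq))

module Completeness (Z : ℕ → Bool)
  (Z-∈ : ∀ {x} → x ∈ A → Z (x + x) ≡ true) (Z-∉ : ∀ {x} → x ∉ A → Z (x + x) ≡ false) where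

  answer : ∀ {x b} → Z (x + x) ≡ b →
           Eventually λ M → Returns (prefix Z M) ⌜ oracle ⌝ (nat x ∙ nat 0) (⟦ pd ⟧ (bit b))
  answer {x} {b} eq = suc (x + x) , λ M le K → next
    (subst (λ st → Reach (prefix Z M) st (rt (⟦ pd ⟧ (bit b)) K))
      (sym (by-bit {prefix Z M} b K (trans (even-bit Z M x le) (cong bit eq)))) stop)
    where
    by-bit : ∀ {ρ} b K → ⟦ evenᵗ ⟧ (ρ ∙ nat x) ≡ bit b →
             step ρ (ev ⌜ oracle ⌝ (nat x ∙ nat 0) K) ≡ rt (⟦ pd ⟧ (bit b)) K
    by-bit false K eq rewrite eq = refl
    by-bit true  K eq rewrite eq = refl

  mutual
    -- The use principle, by induction on the derivation: only oracle calls bound the length of the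
    -- prefix from below, and finitely many subderivations have a common bound.
    returns : {c : Code n} {xs : Vec ℕ n} → A ⊢ c · xs ↓ y →
              Eventually λ M → Returns (prefix Z M) ⌜ c ⌝ ⌜ xs ⌝ᵛ (nat y)
    returns ↓zero = 0 , λ _ _ _ → next stop
    returns ↓suc  = 0 , λ _ _ _ → next stop
    returns (↓proj {xs = xs} i) = 0 , λ M _ K → next
      (subst (λ v → Reach (prefix Z M) (rt (head (fold ⌜ xs ⌝ᵛ tail (toℕ i))) K) (rt v K))
        (lookup-list xs i) stop)
    returns (↓oracle-∈ p) = answer (Z-∈ p)
    returns (↓oracle-∉ p) = answer (Z-∉ p)
    returns (↓comp ps p) =
      let (N , r) = eventually₂ (returns* ps) (returns p)
      in N , λ M le K → let (q* , q) = r M le in next (q* _ ▷ next (q K))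
    returns (↓prec-zero p) =
      let (N , r) = returns p in N , λ M le K → next (r M le K)
    returns (↓prec-suc p p′) =
      let (N , r) = eventually₂ (returns p) (returns p′)
      in N , λ M le K → let (q , q′) = r M le in next (q _ ▷ next (q′ K))
    returns {y = y} (↓μ {f = f} {xs = xs} ps p) =
      let (N , r) = eventually₂ (eventually-< y λ i i<y → below (ps i i<y)) (returns p)
      in N , λ M le K → let (qs , q) = r M le in next (search-loop qs q K y refl)
      where
      below : ∀ {i} → (∃ λ k → A ⊢ f · i ∷ xs ↓ suc k) →
              Eventually λ M → ∃ λ k → Returns (prefix Z M) ⌜ f ⌝ ⌜ i ∷ xs ⌝ᵛ (nat (suc k))
      below (k , p) = let (N , r) = returns p in N , λ M le → k , r M le

    returns* : {gs : Vec (Code n) m} {xs : Vec ℕ n} {ys : Vec ℕ m} →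
               Pointwise (λ g v → A ⊢ g · xs ↓ v) gs ys →
               Eventually λ M → Returns (prefix Z M) ⌜ gs ⌝* ⌜ xs ⌝ᵛ ⌜ ys ⌝ᵛ
    returns* []       = 0 , λ _ _ _ → next stop
    returns* (p ∷ ps) =
      let (N , r) = eventually₂ (returns p) (returns* ps)
      in N , λ M le K → let (q , q*) = r M le in next (q _ ▷ next (q* _ ▷ next stop))

-- Universal computations

startᵗ : Term
startᵗ = evᵗ hd (quo ,ᵗ 0ᵗ) 0ᵗ

opaque
  -- 1 or 2 if the program head d, run on input enc d with oracle string ρ, halts
  -- within s steps with an output that is zero or positive, and 0 otherwise.
  J : Tree → ℕ → Tree → Tree
  J ρ s d = ⟦ outᵗ ⟧ (run ρ (⟦ startᵗ ⟧ d) s)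

  Jᵗ : Term
  Jᵗ = outᵗ ⊙ tl ⊙ iter (hd ,ᵗ stepᵗ) ⊙ (hd ⊙ tl ,ᵗ hd ,ᵗ startᵗ ⊙ tl ⊙ tl)

  ⟦Jᵗ⟧ : ∀ ρ s d → ⟦ Jᵗ ⟧ (ρ ∙ nat s ∙ d) ≡ J ρ s d
  ⟦Jᵗ⟧ ρ s d = cong (λ t → ⟦ outᵗ ⟧ (tail t)) (loop s)
    where
    loop : ∀ s → fold (ρ ∙ ⟦ startᵗ ⟧ d) ⟦ hd ,ᵗ stepᵗ ⟧ s ≡ ρ ∙ run ρ (⟦ startᵗ ⟧ d) s
    loop s = trans (pairs s) (cong (ρ ∙_) (iterate-is-fold _ (step ρ) s))
      where
      pairs : ∀ s → fold (ρ ∙ ⟦ startᵗ ⟧ d) ⟦ hd ,ᵗ stepᵗ ⟧ s ≡ ρ ∙ fold (⟦ startᵗ ⟧ d) (step ρ) s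
      pairs zero    = refl
      pairs (suc s) = cong ⟦ hd ,ᵗ stepᵗ ⟧ (pairs s)

  J-⊑ : ∀ ρ ρ′ {s s′} d → ρ ⊑ ρ′ → s ≤ s′ → J ρ s d ≢ nat 0 → J ρ′ s′ d ≡ J ρ s d
  J-⊑ ρ ρ′ d ρ⊑ρ′ s≤s′ = run-⊑ ρ ρ′ ρ⊑ρ′ (⟦ startᵗ ⟧ d) s≤s′

verdict : ℕ → Tree
verdict zero    = nat 1
verdict (suc _) = nat 2

verdict-≢0 : ∀ y → verdict y ≢ nat 0
verdict-≢0 zero    ()
verdict-≢0 (suc _) ()

opaque
  unfolding J

  -- The program is found in its own input. As the component `d` stays free, this diagonal
  -- computation is universal as well.
  J-complete : (Z : ℕ → Bool) → (∀ {x} → x ∈ A → Z (x + x) ≡ true) →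
               (∀ {x} → x ∉ A → Z (x + x) ≡ false) →
               (c : Code 1) (d : Tree) → A ⊢ c · enc (⌜ c ⌝ ∙ d) ∷ [] ↓ y →
               Eventually λ M → J (prefix Z M) M (⌜ c ⌝ ∙ d) ≡ verdict y
  J-complete {y = y} Z Z-∈ Z-∉ c d p =
    let (N , r)  = Completeness.returns Z Z-∈ Z-∉ p
        (s , eq) = Reach⇒run (r N ≤-refl (nat 0))
        J≡       = trans (cong ⟦ outᵗ ⟧ eq) (out-verdict y)
    -- The halting run is taken with the prefix of length `N`; monotonicity carries its verdict to
    -- every larger `M`.
    in N ⊔ s , λ M le → trans
         (J-⊑ (prefix Z N) (prefix Z M) (⌜ c ⌝ ∙ d) (prefix-⊑ {Z} {Z} (λ _ → refl) (m⊔n≤o⇒m≤o N s le)) (m⊔n≤o⇒n≤o N s le)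
           (λ J≡0 → verdict-≢0 y (trans (sym J≡) J≡0)))
         J≡
    where
    out-verdict : ∀ y → ⟦ outᵗ ⟧ (rt (nat y) (nat 0)) ≡ verdict y
    out-verdict zero    = refl
    out-verdict (suc _) = refl

appendᵗ : Bool → Term
appendᵗ b = sc ⊙ hd ,ᵗ cst (bit b) ,ᵗ tl

zeros : ℕ → Tree
zeros = prefix (λ _ → false)

zerosᵗ : Term
zerosᵗ = iter (appendᵗ false) ⊙ (idᵗ ,ᵗ cst (zeros 0))

⟦zerosᵗ⟧ : ∀ s → ⟦ zerosᵗ ⟧ (nat s) ≡ zeros s
⟦zerosᵗ⟧ zero    = refl
⟦zerosᵗ⟧ (suc s) = cong ⟦ appendᵗ false ⟧ (⟦zerosᵗ⟧ s)

-- Queries are answered as by the empty oracle, and the string grows with `s` so that none stays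
-- blocked.
U : ℕ → Tree → Tree
U s d = J (zeros s) s d

opaque
  Uᵗ : Term
  Uᵗ = Jᵗ ⊙ (zerosᵗ ⊙ hd ,ᵗ idᵗ)

  ⟦Uᵗ⟧ : ∀ s d → ⟦ Uᵗ ⟧ (nat s ∙ d) ≡ U s d
  ⟦Uᵗ⟧ s d = trans (cong (λ ρ → ⟦ Jᵗ ⟧ (ρ ∙ nat s ∙ d)) (⟦zerosᵗ⟧ s)) (⟦Jᵗ⟧ (zeros s) s d)

U-mono : ∀ d {s s′} → s ≤ s′ → U s d ≢ nat 0 → U s′ d ≡ U s d
U-mono d {s} {s′} s≤s′ = J-⊑ (zeros s) (zeros s′) d
  (prefix-⊑ {λ _ → false} {λ _ → false} (λ _ → refl) s≤s′) s≤s′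

U-complete : (c : Code 1) (d : Tree) → ∅ ⊢ c · enc (⌜ c ⌝ ∙ d) ∷ [] ↓ y →
             ∃ λ s → U s (⌜ c ⌝ ∙ d) ≡ verdict y
U-complete c d p =
  let (N , r) = J-complete (λ _ → false) (λ ()) (λ _ → refl) c d p in N , r N ≤-refl

-- Ceers with finitely many nontrivial classes

opaque
  subᵗ eqᵗ : Term
  subᵗ = iter pd ⊙ (quo ⊙ hd ,ᵗ quo ⊙ tl)
  eqᵗ  = ifz subᵗ (subᵗ ⊙ (tl ,ᵗ hd)) 1ᵗ

  eq-refl : ∀ d → ⟦ eqᵗ ⟧ (d ∙ d) ≡ nat 0
  eq-refl d rewrite fold-pd (enc d) (enc d) | n∸n≡0 (enc d) = refl

  eq-sound : ∀ d d′ → ⟦ eqᵗ ⟧ (d ∙ d′) ≡ nat 0 → d ≡ d′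
  eq-sound d d′ p rewrite fold-pd (enc d) (enc d′) | fold-pd (enc d′) (enc d)
    with enc d′ ∸ enc d in p₁ | enc d ∸ enc d′ in p₂
  ... | zero | zero = enc-injective d d′ (≤-antisym (m∸n≡0⇒m≤n p₂) (m∸n≡0⇒m≤n p₁))
  eq-sound d d′ () | zero | suc _
  eq-sound d d′ () | suc _ | _

-- At stage `s` the term `c` may give a tree a label, which is then final; `nat 0` means none so
-- far. Elements with a common label are identified, all others stay alone.
module Classes (c : Term)
  (mono : ∀ d {s s′} → s ≤ s′ → ⟦ c ⟧ (nat s ∙ d) ≢ nat 0 →
          ⟦ c ⟧ (nat s′ ∙ d) ≡ ⟦ c ⟧ (nat s ∙ d)) where

  Class : Tree → ℕ → Set
  Class t x = ∃ λ s → ⟦ c ⟧ (nat s ∙ dec x) ≡ t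

  infix 4 _∼_

  _∼_ : ℕ → ℕ → Set
  x ∼ y = x ≡ y ⊎ ∃ λ t → t ≢ nat 0 × Class t x × Class t y

  Class-later : ∀ {t s s′} x → t ≢ nat 0 → s ≤ s′ →
                ⟦ c ⟧ (nat s ∙ dec x) ≡ t → ⟦ c ⟧ (nat s′ ∙ dec x) ≡ t
  Class-later x t≢0 s≤s′ eq = trans (mono (dec x) s≤s′ (λ e → t≢0 (trans (sym eq) e))) eq

  Class-unique : ∀ {t t′} x → t ≢ nat 0 → t′ ≢ nat 0 → Class t x → Class t′ x → t ≡ t′
  Class-unique x t≢0 t′≢0 (s , p) (s′ , q) =
    trans (sym (Class-later x t≢0 (m≤m⊔n s s′) p)) (Class-later x t′≢0 (m≤n⊔m s s′) q)

  ∼-isEquivalence : IsEquivalence _∼_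
  ∼-isEquivalence = record
    { refl  = inj₁ refl
    ; sym   = λ { (inj₁ eq) → inj₁ (sym eq) ; (inj₂ (t , t≢0 , p , q)) → inj₂ (t , t≢0 , q , p) }
    ; trans = λ where
        (inj₁ refl) q → q
        p (inj₁ refl) → p
        {j = y} (inj₂ (t , t≢0 , p , q)) (inj₂ (t′ , t′≢0 , p′ , q′)) →
          inj₂ (t , t≢0 , p , subst (λ u → Class u _) (Class-unique y t′≢0 t≢0 p′ q) q′)
    }

  testᵗ : Term
  testᵗ = ifz (eqᵗ ⊙ tl) 0ᵗ
    -- Without this test two elements that have no label yet would be identified.
    (ifz (c ⊙ (hd ,ᵗ hd ⊙ tl)) 1ᵗ (eqᵗ ⊙ (c ⊙ (hd ,ᵗ hd ⊙ tl) ,ᵗ c ⊙ (hd ,ᵗ tl ⊙ tl))))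

  test⇒∼ : ∀ s x y → ⟦ testᵗ ⟧ (nat s ∙ dec x ∙ dec y) ≡ nat 0 → x ∼ y
  test⇒∼ s x y p with zero? (⟦ eqᵗ ⟧ (dec x ∙ dec y))
  ... | inj₁ eq = inj₁ (trans (sym (enc-dec x))
                    (trans (cong enc (eq-sound (dec x) (dec y) eq)) (enc-dec y)))
  ... | inj₂ ≢0 with zero? (⟦ c ⟧ (nat s ∙ dec x))
  ...   | inj₁ eq = contradiction (trans (sym (trans (if0-nonzero ≢0) (if0-zero eq))) p) λ ()
  ...   | inj₂ c≢0 = inj₂ (_ , c≢0 , (s , refl) , (s , sym (eq-sound _ _
                       (trans (sym (trans (if0-nonzero ≢0) (if0-nonzero c≢0))) p))))

  ∼⇒test : ∀ x y → x ∼ y → ∃ λ s → ⟦ testᵗ ⟧ (nat s ∙ dec x ∙ dec y) ≡ nat 0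
  ∼⇒test x .x (inj₁ refl) = 0 , if0-zero (eq-refl (dec x))
  ∼⇒test x y (inj₂ (t , t≢0 , (s , p) , (s′ , q)))
    with zero? (⟦ eqᵗ ⟧ (dec x ∙ dec y))
       | Class-later x t≢0 (m≤m⊔n s s′) p | Class-later y t≢0 (m≤n⊔m s s′) q
  ... | inj₁ eq | _  | _  = s ⊔ s′ , if0-zero eq
  ... | inj₂ ≢0 | p′ | q′ = s ⊔ s′ , trans (if0-nonzero ≢0)
    (trans (if0-nonzero λ e → t≢0 (trans (sym p′) e))
      (trans (cong₂ (λ u v → ⟦ eqᵗ ⟧ (u ∙ v)) p′ q′) (eq-refl t)))

  semideciderᶜ : Code 2
  semideciderᶜ = μ (comp (code testᵗ)
    (comp nodeᶜ (comp natᶜ (proj zero ∷ []) ∷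
                 comp nodeᶜ (proj (suc zero) ∷ proj (suc (suc zero)) ∷ []) ∷ []) ∷ []))

  ∼-isCE : CERel _∼_
  ∼-isCE = semideciderᶜ , λ x y → mk⇔ (halts x y) (λ (s , p) → sound x y s p)
    where
    ↓pairing : ∀ x y → ∅ ⊢ nodeᶜ · x ∷ y ∷ [] ↓ enc (dec x ∙ dec y)
    ↓pairing x y = subst₂ (λ i j → ∅ ⊢ nodeᶜ · i ∷ j ∷ [] ↓ enc (dec x ∙ dec y))
      (enc-dec x) (enc-dec y) (↓node (dec x) (dec y))

    ↓test : ∀ x y s → ∅ ⊢ _ · s ∷ x ∷ y ∷ [] ↓ enc (⟦ testᵗ ⟧ (nat s ∙ dec x ∙ dec y))
    ↓test x y s = ↓comp₁
      (↓comp₂ (↓comp₁ (↓proj zero) (↓nat s))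
              (↓comp₂ (↓proj (suc zero)) (↓proj (suc (suc zero))) (↓pairing x y))
              (↓node (nat s) (dec x ∙ dec y)))
      (↓code testᵗ (nat s ∙ dec x ∙ dec y))

    halts : ∀ x y → x ∼ y → ∃ λ z → ∅ ⊢ semideciderᶜ · x ∷ y ∷ [] ↓ z
    halts x y x∼y =
      let (s , eq)    = ∼⇒test x y x∼y
          (z , _ , p) = ↓search _ (↓test x y) s (trans (cong enc eq) pair-00)
      in z , p

    sound : ∀ x y z → ∅ ⊢ semideciderᶜ · x ∷ y ∷ [] ↓ z → x ∼ y
    sound x y z (↓μ _ p) = test⇒∼ z x y (enc≡0⇒ _ (↓-det (↓test x y z) p))

  ceer : Ceer
  ceer = record { _∼_ = _∼_ ; isEquivalence = ∼-isEquivalence ; isCE = ∼-isCE }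

-- The two ceers

side : Tree → Tree
side d = if0 (head d) (nat 2) (nat 1)

opaque
  -- Trees with head `nat 0` form the copy in which `W (nat 2)` is collapsed, all others the copy
  -- for `W (nat 1)`. A label is kept only in its own copy.
  Sᵗ : Term
  Sᵗ = ifz (eqᵗ ⊙ (sideᵗ ,ᵗ Uᵗ ⊙ (hd ,ᵗ tl ⊙ tl))) sideᵗ 0ᵗ
    where
    sideᵗ : Term
    sideᵗ = ifz (hd ⊙ tl) 2ᵗ 1ᵗ

  ⟦Sᵗ⟧ : ∀ s d → ⟦ Sᵗ ⟧ (nat s ∙ d) ≡ if0 (⟦ eqᵗ ⟧ (side d ∙ U s (tail d))) (side d) (nat 0)
  ⟦Sᵗ⟧ s d = cong (λ u → if0 (⟦ eqᵗ ⟧ (side d ∙ u)) (side d) (nat 0)) (⟦Uᵗ⟧ s (tail d))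

S-sound : ∀ s d {t} → t ≢ nat 0 → ⟦ Sᵗ ⟧ (nat s ∙ d) ≡ t → side d ≡ t × U s (tail d) ≡ t
S-sound s d {t} t≢0 eq with zero? (⟦ eqᵗ ⟧ (side d ∙ U s (tail d))) | trans (sym (⟦Sᵗ⟧ s d)) eq
... | inj₂ ≢0 | eq′ = contradiction (trans (sym eq′) (if0-nonzero ≢0)) t≢0
... | inj₁ ≡0 | eq′ with refl ← trans (sym (if0-zero ≡0)) eq′ = refl , sym (eq-sound _ _ ≡0)

S-complete : ∀ s d {t} → side d ≡ t → U s (tail d) ≡ t → ⟦ Sᵗ ⟧ (nat s ∙ d) ≡ t
S-complete s d refl eq = trans (⟦Sᵗ⟧ s d)
  (if0-zero (trans (cong (λ u → ⟦ eqᵗ ⟧ (side d ∙ u)) eq) (eq-refl (side d))))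

R-mono : ∀ d {s s′} → s ≤ s′ → ⟦ Uᵗ ⟧ (nat s ∙ d) ≢ nat 0 → ⟦ Uᵗ ⟧ (nat s′ ∙ d) ≡ ⟦ Uᵗ ⟧ (nat s ∙ d)
R-mono d {s} {s′} s≤s′ ≢0 = trans (⟦Uᵗ⟧ s′ d)
  (trans (U-mono d s≤s′ (λ e → ≢0 (trans (⟦Uᵗ⟧ s d) e))) (sym (⟦Uᵗ⟧ s d)))

S-mono : ∀ d {s s′} → s ≤ s′ → ⟦ Sᵗ ⟧ (nat s ∙ d) ≢ nat 0 → ⟦ Sᵗ ⟧ (nat s′ ∙ d) ≡ ⟦ Sᵗ ⟧ (nat s ∙ d)
S-mono d {s} {s′} s≤s′ ≢0 =
  let (p , q) = S-sound s d ≢0 refl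
  in S-complete s′ d p (trans (U-mono (tail d) s≤s′ (λ e → ≢0 (trans (sym q) e))) q)

module R = Classes Uᵗ R-mono
module S = Classes Sᵗ S-mono

W : Tree → Pred ℕ 0ℓ
W t x = ∃ λ s → U s (dec x) ≡ t

R-class : ∀ {t} x → R.Class t x → W t x
R-class x (s , eq) = s , trans (sym (⟦Uᵗ⟧ s (dec x))) eq

class-R : ∀ {t} x → W t x → R.Class t x
class-R x (s , eq) = s , trans (⟦Uᵗ⟧ s (dec x)) eq

W-complete : (c : Code 1) (d : Tree) → ∅ ⊢ c · enc (⌜ c ⌝ ∙ d) ∷ [] ↓ y →
             W (verdict y) (enc (⌜ c ⌝ ∙ d))
W-complete {y = y} c d p = subst (λ e → ∃ λ s → U s e ≡ verdict y) (sym (dec-enc (⌜ c ⌝ ∙ d))) (U-complete c d p)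

-- The tag 9 names no instruction, so the machine never halts on idle trees.
idle : ℕ → Tree
idle n = (nat 9 ∙ nat 0) ∙ nat n

opaque
  unfolding J

  U-idle : ∀ s n → U s (idle n) ≡ nat 0
  U-idle s n = cong ⟦ outᵗ ⟧ (iterate-fixed {f = step (zeros s)} refl s)

idle-injective : idle m ≡ idle n → m ≡ n
idle-injective refl = refl

R-infinite : InfinitelyManyClasses R._∼_
R-infinite = (λ n → enc (idle n)) , λ where
  (inj₁ eq) → idle-injective (enc-injective _ _ eq)
  {m} (inj₂ (t , t≢0 , p , _)) → let (s , eq) = R-class (enc (idle m)) p in
    contradiction (trans (sym eq) (trans (cong (U s) (dec-enc (idle m))) (U-idle s m))) t≢0

S-infinite : InfinitelyManyClasses S._∼_
S-infinite = (λ n → enc (nat 0 ∙ idle n)) , λ where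
  (inj₁ eq) → idle-injective (cong tail (enc-injective (nat 0 ∙ idle _) (nat 0 ∙ idle _) eq))
  {m} (inj₂ (t , t≢0 , (s , eq) , _)) → let (_ , eq′) = S-sound s (dec (enc (nat 0 ∙ idle m))) t≢0 eq in
    contradiction (trans (sym eq′)
      (trans (cong (λ d → U s (tail d)) (dec-enc (nat 0 ∙ idle m))) (U-idle s m))) t≢0

-- Reductions of R to S and separators of W (nat 1) and W (nat 2)

Separator : Pred (Pred ℕ 0ℓ) 0ℓ
Separator C = ∀ x → (W (nat 1) x → x ∈ C) × (W (nat 2) x → x ∉ C)

opaque
  unfolding J

  U-range : ∀ s d → U s d ≢ nat 0 → U s d ≡ nat 1 ⊎ U s d ≡ nat 2
  U-range s d = out-range (run (zeros s) (⟦ startᵗ ⟧ d) s)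
    where
    out-range : ∀ st → ⟦ outᵗ ⟧ st ≢ nat 0 → ⟦ outᵗ ⟧ st ≡ nat 1 ⊎ ⟦ outᵗ ⟧ st ≡ nat 2
    out-range st ≢0 with zero? (head st) | zero? (tail (tail st)) | zero? (head (tail st))
    ... | inj₁ a | _      | _      = contradiction (if0-zero a) ≢0
    ... | inj₂ a | inj₂ b | _      = contradiction (trans (if0-nonzero a) (if0-nonzero b)) ≢0
    ... | inj₂ a | inj₁ b | inj₁ c = inj₁ (trans (if0-nonzero a) (trans (if0-zero b) (if0-zero c)))
    ... | inj₂ a | inj₁ b | inj₂ c = inj₂ (trans (if0-nonzero a) (trans (if0-zero b) (if0-nonzero c)))

dec-injective : dec x ≡ dec y → x ≡ y
dec-injective eq = trans (sym (enc-dec _)) (trans (cong enc eq) (enc-dec _))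

module _ (em : ExcludedMiddle 0ℓ) {C : Pred ℕ 0ℓ} (sep : Separator C) where

  private
    χ : ℕ → ℕ
    χ x with em {x ∈ C}
    ... | yes _ = 1
    ... | no  _ = 0

    ↓χ : ∀ x → C ⊢ oracle · x ∷ [] ↓ χ x
    ↓χ x with em {x ∈ C}
    ... | yes x∈C = ↓oracle-∈ x∈C
    ... | no  x∉C = ↓oracle-∉ x∉C

    f : ℕ → ℕ
    f x = enc (nat (χ x) ∙ dec x)

    -- Separation is used here: label 1 forces membership in `C` and label 2 excludes it, so the
    -- chosen copy is the one that keeps the label.
    side-χ : ∀ {t} x s → t ≢ nat 0 → U s (dec x) ≡ t → side (nat (χ x) ∙ dec x) ≡ t
    side-χ x s t≢0 refl with em {x ∈ C} | U-range s (dec x) t≢0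
    ... | yes _   | inj₁ eq = sym eq
    ... | yes x∈C | inj₂ eq = contradiction x∈C (proj₂ (sep x) (s , eq))
    ... | no x∉C  | inj₁ eq = contradiction (proj₁ (sep x) (s , eq)) x∉C
    ... | no _    | inj₂ eq = sym eq

    class-f : ∀ {t} x → t ≢ nat 0 → W t x → S.Class t (f x)
    class-f {t} x t≢0 (s , eq) = s , subst (λ d → ⟦ Sᵗ ⟧ (nat s ∙ d) ≡ t) (sym (dec-enc (nat (χ x) ∙ dec x)))
      (S-complete s (nat (χ x) ∙ dec x) (side-χ x s t≢0 eq) eq)

    f-class : ∀ {t} x → t ≢ nat 0 → S.Class t (f x) → W t x
    f-class {t} x t≢0 (s , eq) = s , proj₂ (S-sound s (nat (χ x) ∙ dec x) t≢0
      (subst (λ d → ⟦ Sᵗ ⟧ (nat s ∙ d) ≡ t) (dec-enc (nat (χ x) ∙ dec x)) eq))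

    f-injective : ∀ x y → f x ≡ f y → x ≡ y
    f-injective x y eq =
      dec-injective (cong tail (enc-injective (nat (χ x) ∙ dec x) (nat (χ y) ∙ dec y) eq))

  separator⇒reduction : R._∼_ ≤[ C ] S._∼_
  separator⇒reduction = f ,
    (comp nodeᶜ (comp natᶜ (oracle ∷ []) ∷ proj zero ∷ []) ,
     λ x → ↓comp₂ (↓comp₁ (↓χ x) (↓nat _)) (↓proj zero) (↓node-dec _ x)) ,
    λ x y → mk⇔
      (λ { (inj₁ refl) → inj₁ refl
         ; (inj₂ (t , t≢0 , p , q)) → inj₂ (t , t≢0 ,
             class-f x t≢0 (R-class x p) , class-f y t≢0 (R-class y q)) })
      (λ { (inj₁ eq) → inj₁ (f-injective x y eq)
         ; (inj₂ (t , t≢0 , p , q)) → inj₂ (t , t≢0 ,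
             class-R x (f-class x t≢0 p) , class-R y (f-class y t≢0 q)) })

module _ (em : ExcludedMiddle 0ℓ) {C : Pred ℕ 0ℓ} (red : R._∼_ ≤[ C ] S._∼_) where

  private
    f : ℕ → ℕ
    f = proj₁ red

    a b : ℕ
    -- Inputs carrying a program with constant output 0, respectively 1, serve as representatives of
    -- the two sets.
    a = enc (⌜ zeroᶜ {1} ⌝ ∙ nat 0)
    b = enc (⌜ constᶜ {1} 1 ⌝ ∙ nat 0)

    a∈W : W (nat 1) a
    a∈W = W-complete zeroᶜ (nat 0) ↓zero

    b∈W : W (nat 2) b
    b∈W = W-complete (constᶜ 1) (nat 0) (↓const 1)

    forth : ∀ {x y} → x R.∼ y → f x S.∼ f y
    forth {x} {y} = Equivalence.to (proj₂ (proj₂ red) x y)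

    back : ∀ {x y} → f x S.∼ f y → x R.∼ y
    back {x} {y} = Equivalence.from (proj₂ (proj₂ red) x y)

    ∼a : ∀ x → W (nat 1) x → f x S.∼ f a
    ∼a x x∈W = forth (inj₂ (nat 1 , (λ ()) , class-R x x∈W , class-R a a∈W))

    ∼b : ∀ x → W (nat 2) x → f x S.∼ f b
    ∼b x x∈W = forth (inj₂ (nat 2 , (λ ()) , class-R x x∈W , class-R b b∈W))

    1≢2 : nat 1 ≢ nat 2
    1≢2 ()

    a≁b : ¬ (f a S.∼ f b)
    a≁b fa∼fb with back fa∼fb
    ... | inj₁ a≡b = 1≢2 (R.Class-unique b (λ ()) (λ ())
                       (subst (R.Class (nat 1)) a≡b (class-R a a∈W)) (class-R b b∈W))
    ... | inj₂ (t , t≢0 , p , q) = 1≢2 (trans (R.Class-unique a (λ ()) t≢0 (class-R a a∈W) p)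
                                              (R.Class-unique b t≢0 (λ ()) q (class-R b b∈W)))

    Accepted : Term → Pred ℕ 0ℓ
    Accepted p x = ⟦ p ⟧ (dec (f x)) ≡ nat 0

    -- All of `W (nat 1)` is sent to the class of `f a` and all of `W (nat 2)` to that of `f b`. A
    -- test of `f x` that tells these classes apart thus yields a separator, decided by first
    -- computing `f` from `C`.
    by-term : (p : Term) → (∀ x → f x S.∼ f a → x ∈ Accepted p) →
              (∀ x → f x S.∼ f b → x ∉ Accepted p) → ∃ λ D → Separator D × D ≤T C
    by-term p pa pb = Accepted p ,
      (λ x → (λ x∈W → pa x (∼a x x∈W)) , (λ x∈W → pb x (∼b x x∈W))) ,
      comp sndᶜ (comp (code (ifz p 1ᵗ 0ᵗ)) (proj₁ (proj₁ (proj₂ red)) ∷ []) ∷ []) ,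
      λ x → (λ eq → ↓decision x 1 (if0-zero eq)) , (λ ≢0 → ↓decision x 0 (if0-nonzero ≢0))
      where
      ↓decision : ∀ x n → ⟦ ifz p 1ᵗ 0ᵗ ⟧ (dec (f x)) ≡ nat n → _
      ↓decision x n eq = ↓comp₁
        (↓comp₁ (proj₂ (proj₁ (proj₂ red)) x)
          (↓-resp (cong enc eq) (↓code-dec (ifz p 1ᵗ 0ᵗ) (f x))))
        (↓val (nat n))

    Classified : Pred ℕ 0ℓ
    Classified x = ∃ λ t → t ≢ nat 0 × S.Class t x

    is : ℕ → Term
    is x = eqᵗ ⊙ (idᵗ ,ᵗ cst (dec x))

    is-refl : ∀ {x y} → x ≡ y → ⟦ is x ⟧ (dec y) ≡ nat 0
    is-refl refl = eq-refl (dec _)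

    is-sound : ∀ {x y} → ⟦ is x ⟧ (dec y) ≡ nat 0 → y ≡ x
    is-sound eq = dec-injective (eq-sound _ _ eq)

    unclassified : ∀ {x y} → ¬ Classified y → x S.∼ y → y ≡ x
    unclassified ¬cl (inj₁ x≡y)                 = sym x≡y
    unclassified ¬cl (inj₂ (t , t≢0 , _ , q)) = contradiction (t , t≢0 , q) ¬cl

    class-side : ∀ {t} x → t ≢ nat 0 → S.Class t x → side (dec x) ≡ t
    class-side x t≢0 (s , eq) = proj₁ (S-sound s (dec x) t≢0 eq)

    ∼-side : ∀ {t x y} → t ≢ nat 0 → S.Class t y → x S.∼ y → side (dec x) ≡ t
    ∼-side {y = y} t≢0 y∈t (inj₁ refl) = class-side y t≢0 y∈t
    ∼-side {x = x} {y} t≢0 y∈t (inj₂ (u , u≢0 , p , q)) =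
      trans (class-side x u≢0 p) (S.Class-unique y u≢0 t≢0 q y∈t)

  reduction⇒separator : ∃ λ D → Separator D × D ≤T C
  reduction⇒separator with em {Classified (f a)} | em {Classified (f b)}
  -- An unlabelled `f a` is alone in its class, so equality with it is the test.
  ... | no ¬cl | _ = by-term (is (f a))
    (λ x x∼a → is-refl (unclassified ¬cl x∼a))
    (λ x x∼b eq → a≁b (subst (S._∼ f b) (is-sound eq) x∼b))
  ... | yes _ | no ¬cl = by-term (ifz (is (f b)) 1ᵗ 0ᵗ)
    (λ x x∼a → if0-nonzero λ eq → a≁b
      (subst (f a S.∼_) (is-sound eq) (IsEquivalence.sym S.∼-isEquivalence x∼a)))
    (λ x x∼b eq → contradiction
      (trans (sym (if0-zero (is-refl (unclassified ¬cl x∼b)))) eq) λ ())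
  -- The copy is constant on each of the two classes. If both lay in the same copy, `f a` and `f b`
  -- would share a label and be equivalent.
  ... | yes (t , t≢0 , p) | yes (u , u≢0 , q) = by-term
    (eqᵗ ⊙ (ifz hd 2ᵗ 1ᵗ ,ᵗ cst t))
    (λ x x∼a → trans (cong (λ v → ⟦ eqᵗ ⟧ (v ∙ t)) (∼-side t≢0 p x∼a)) (eq-refl t))
    (λ x x∼b eq → a≁b (inj₂ (t , t≢0 , p ,
      subst (λ v → S.Class v (f b)) (trans (sym (∼-side u≢0 q x∼b)) (eq-sound _ _ eq)) q)))

-- The tree of pairs of a separator and a set not computable from it

evens odds : (ℕ → Bool) → Pred ℕ 0ℓ
evens Z x = Z (x + x) ≡ true
odds  Z x = Z (suc (x + x)) ≡ true

opaque
  clashᵗ badᵗ : Term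
  clashᵗ = ifz hd 1ᵗ eqᵗ

  -- A string of length enc (t ∙ d ∙ _) is only tested for a clash at d, on the
  -- even or the odd positions according to t.
  badᵗ = ifz (hd ⊙ i)
    (clashᵗ ⊙ (Uᵗ ⊙ (hd ,ᵗ e) ,ᵗ evenᵗ ⊙ (idᵗ ,ᵗ quo ⊙ e)))
    (clashᵗ ⊙ (Jᵗ ⊙ (idᵗ ,ᵗ hd ,ᵗ e) ,ᵗ oddᵗ ⊙ (idᵗ ,ᵗ quo ⊙ e)))
    where
    i e : Term
    i = tl ⊙ hd
    e = hd ⊙ tl ⊙ i

Bad : Tree → Set
Bad σ = ⟦ badᵗ ⟧ σ ≡ nat 0

-- Verdict 1 rules out the bit `false` and verdict 2 the bit `true`, so the even half is a
-- separator. The odd half diagonalises against the programs whose oracle is the even half.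
record Good (Z : ℕ → Bool) : Set where
  field
    even-≢ : ∀ s d → U s d ≢ bit (Z (enc d + enc d))
    odd-≢  : ∀ s d → J (prefix Z s) s d ≢ bit (Z (suc (enc d + enc d)))

open Good

bit≢0 : ∀ b → bit b ≢ nat 0
bit≢0 false ()
bit≢0 true  ()

opaque
  unfolding clashᵗ

  clash-sound : ∀ u v → ⟦ clashᵗ ⟧ (u ∙ v) ≡ nat 0 → u ≢ nat 0 × u ≡ v
  clash-sound u v eq with zero? u
  ... | inj₁ u≡0 = contradiction (trans (sym (if0-zero u≡0)) eq) λ ()
  ... | inj₂ u≢0 = u≢0 , eq-sound u v (trans (sym (if0-nonzero u≢0)) eq)

  clash-complete : ∀ u v b → u ≡ bit b → v ≡ bit b → ⟦ clashᵗ ⟧ (u ∙ v) ≡ nat 0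
  clash-complete _ _ b refl refl = trans (if0-nonzero (bit≢0 b)) (eq-refl (bit b))

Bad-at : (Z : ℕ → Bool) (L : ℕ) (t d : Tree) → Tree
Bad-at Z L t d = if0 t
  (⟦ clashᵗ ⟧ (U L d ∙ ⟦ evenᵗ ⟧ (prefix Z L ∙ nat (enc d))))
  (⟦ clashᵗ ⟧ (J (prefix Z L) L d ∙ ⟦ oddᵗ ⟧ (prefix Z L ∙ nat (enc d))))

opaque
  unfolding badᵗ

  ⟦badᵗ⟧ : ∀ Z L → ⟦ badᵗ ⟧ (prefix Z L) ≡ Bad-at Z L (head (dec L)) (head (tail (dec L)))
  ⟦badᵗ⟧ Z L = cong₂ (if0 (head (dec L)))
    (cong (λ u → ⟦ clashᵗ ⟧ (u ∙ ⟦ evenᵗ ⟧ (prefix Z L ∙ nat (enc e)))) (⟦Uᵗ⟧ L e))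
    (cong (λ u → ⟦ clashᵗ ⟧ (u ∙ ⟦ oddᵗ ⟧ (prefix Z L ∙ nat (enc e)))) (⟦Jᵗ⟧ (prefix Z L) L e))
    where
    e : Tree
    e = head (tail (dec L))

Good⇒¬Bad : ∀ {Z} → Good Z → ∀ L → ¬ Bad (prefix Z L)
Good⇒¬Bad {Z} good L bad = cases (head (dec L)) (trans (sym (⟦badᵗ⟧ Z L)) bad)
  where
  e : Tree
  e = head (tail (dec L))

  even-case : ⟦ clashᵗ ⟧ (U L e ∙ ⟦ evenᵗ ⟧ (prefix Z L ∙ nat (enc e))) ≢ nat 0
  even-case eq with clash-sound _ _ eq | enc e + enc e <? L
  ... | (_  , p) | yes <L = even-≢ good L e (trans p (even-bit Z L (enc e) <L))
  ... | (≢0 , p) | no ≮L  = ≢0 (trans p (even-short Z L (enc e) (≮⇒≥ ≮L)))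

  odd-case : ⟦ clashᵗ ⟧ (J (prefix Z L) L e ∙ ⟦ oddᵗ ⟧ (prefix Z L ∙ nat (enc e))) ≢ nat 0
  odd-case eq with clash-sound _ _ eq | suc (enc e + enc e) <? L
  ... | (_  , p) | yes <L = odd-≢ good L e (trans p (odd-bit Z L (enc e) <L))
  ... | (≢0 , p) | no ≮L  = ≢0 (trans p (odd-short Z L (enc e) (≮⇒≥ ≮L)))

  cases : ∀ t → Bad-at Z L t e ≢ nat 0
  cases t eq with zero? t
  ... | inj₁ t≡0 = even-case (trans (sym (if0-zero t≡0)) eq)
  ... | inj₂ t≢0 = odd-case (trans (sym (if0-nonzero t≢0)) eq)

¬Bad⇒Good : ∀ {Z} → (∀ L → ¬ Bad (prefix Z L)) → Good Z
¬Bad⇒Good {Z} ¬bad = record { even-≢ = even-avoids ; odd-≢ = odd-avoids }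
  where
  ≢0 : ∀ {u b} → u ≡ bit b → u ≢ nat 0
  ≢0 {b = b} eq u≡0 = bit≢0 b (trans (sym eq) u≡0)

  -- The padding yields a tested length of at least `s` that also exceeds both positions belonging
  -- to `d`, so that a clash within `s` steps is noticed.
  pad : Tree → ℕ → Tree → Tree
  pad t s d = t ∙ d ∙ nat (s + suc (suc (enc d + enc d)))

  len : Tree → ℕ → Tree → ℕ
  len t s d = enc (pad t s d)

  len-≥ : ∀ t s d → s + suc (suc (enc d + enc d)) ≤ len t s d
  len-≥ t s d = ≤-trans (pair-≥ 0 (s + suc (suc (enc d + enc d))))
    (≤-trans (enc-≥ d (nat (s + suc (suc (enc d + enc d)))))
      (enc-≥ t (d ∙ nat (s + suc (suc (enc d + enc d))))))

  len-s : ∀ t s d → s ≤ len t s d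
  len-s t s d = ≤-trans (m≤m+n s _) (len-≥ t s d)

  len-bits : ∀ t s d → suc (enc d + enc d) < len t s d
  len-bits t s d = ≤-trans (m≤n+m _ s) (len-≥ t s d)

  ¬Bad-at : ∀ t s d → Bad-at Z (len t s d) t d ≢ nat 0
  ¬Bad-at t s d eq = ¬bad (len t s d) (trans (⟦badᵗ⟧ Z (len t s d))
    (trans (cong (λ e → Bad-at Z (len t s d) (head e) (head (tail e))) (dec-enc (pad t s d))) eq))

  even-avoids : ∀ s d → U s d ≢ bit (Z (enc d + enc d))
  even-avoids s d eq = ¬Bad-at (nat 0) s d (clash-complete (U L d) _ (Z (enc d + enc d))
    (trans (U-mono d (len-s (nat 0) s d) (≢0 eq)) eq)
    (even-bit Z L (enc d) (<-trans (n<1+n _) (len-bits (nat 0) s d))))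
    where
    L : ℕ
    L = len (nat 0) s d

  odd-avoids : ∀ s d → J (prefix Z s) s d ≢ bit (Z (suc (enc d + enc d)))
  odd-avoids s d eq = ¬Bad-at (nat 1) s d (clash-complete (J (prefix Z L) L d) _ (Z (suc (enc d + enc d)))
    (trans (J-⊑ (prefix Z s) (prefix Z L) d (prefix-⊑ {Z} {Z} (λ _ → refl) s≤L) s≤L (≢0 eq)) eq)
    (odd-bit Z L (enc d) (len-bits (nat 1) s d)))
    where
    L : ℕ
    L = len (nat 1) s d
    s≤L : s ≤ L
    s≤L = len-s (nat 1) s d

mix : (f g : ℕ → Bool) → ℕ → Bool
mix f g zero    = f 0
mix f g (suc n) = mix g (λ k → f (suc k)) n

mix-even : ∀ f g n → mix f g (n + n) ≡ f n
mix-even f g zero    = refl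
mix-even f g (suc n) rewrite +-suc n n = mix-even (λ k → f (suc k)) (λ k → g (suc k)) n

mix-odd : ∀ f g n → mix f g (suc (n + n)) ≡ g n
mix-odd f g n = mix-even g (λ k → f (suc k)) n

module _ (em : ExcludedMiddle 0ℓ) where

  -- At each argument `F` settles on at most one nonzero value. The bit is `true` exactly if
  -- `nat 1`, the code of `false`, ever appears.
  avoider : (F : ℕ → Tree → Tree) →
            (∀ d {s s′} → s ≤ s′ → F s d ≢ nat 0 → F s′ d ≡ F s d) →
            ∃ λ (B : ℕ → Bool) → ∀ s d → F s d ≢ bit (B (enc d))
  avoider F mono = B , avoids
    where
    B : ℕ → Bool
    B n = does (em {∃ λ s → F s (dec n) ≡ nat 1})

    avoids : ∀ s d → F s d ≢ bit (B (enc d))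
    avoids s d eq with em {∃ λ s → F s (dec (enc d)) ≡ nat 1}
    ... | no none = none (s , trans (cong (F s) (dec-enc d)) eq)
    ... | yes (s′ , eq′) rewrite dec-enc d = contradiction
      (trans (sym eq′) (trans (sym (mono d (m≤n⊔m s s′) λ e → contradiction (trans (sym eq′) e) λ ()))
        (trans (mono d (m≤m⊔n s s′) λ e → contradiction (trans (sym eq) e) λ ()) eq))) λ ()

  -- A path obtained without regard to computability; it shows that the root of the tree is alive.
  good-exists : ∃ λ Z → Good Z
  good-exists = mix X Y , record
    { even-≢ = λ s d eq → X-avoids s d (trans eq (cong bit (mix-even X Y (enc d))))
    ; odd-≢  = λ s d eq → Y-avoids s d
        (trans (J-⊑ (prefix (mix X Y) s) (prefix X₀ s) d
                 (prefix-⊑ {mix X Y} {X₀} (λ m → trans (mix-even X Y m) (sym (mix-even X _ m))) ≤-refl)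
                 (≤-refl {s}) (λ e → bit≢0 _ (trans (sym eq) e)))
          (trans eq (cong bit (mix-odd X Y (enc d)))))
    }
    where
    X : ℕ → Bool
    X = proj₁ (avoider U U-mono)
    X-avoids : ∀ s d → U s d ≢ bit (X (enc d))
    X-avoids = proj₂ (avoider U U-mono)
    -- The odd half has to avoid computations relative to `X` before it is itself defined. Dummy odd
    -- bits do for this, as the machine never reads them.
    X₀ : ℕ → Bool
    X₀ = mix X (λ _ → false)
    J₀ : ∃ λ (B : ℕ → Bool) → ∀ s d → J (prefix X₀ s) s d ≢ bit (B (enc d))
    J₀ = avoider (λ s → J (prefix X₀ s) s) λ d {s} {s′} s≤s′ →
      J-⊑ (prefix X₀ s) (prefix X₀ s′) d (prefix-⊑ {X₀} {X₀} (λ _ → refl) s≤s′) s≤s′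
    Y : ℕ → Bool
    Y = proj₁ J₀
    Y-avoids : ∀ s d → J (prefix X₀ s) s d ≢ bit (Y (enc d))
    Y-avoids = proj₂ J₀

bit≢1⇒true : ∀ b → bit b ≢ nat 1 → b ≡ true
bit≢1⇒true false ≢1 = contradiction refl ≢1
bit≢1⇒true true  _  = refl

Good⇒separator : ∀ {Z} → Good Z → Separator (evens Z)
Good⇒separator {Z} good x =
  (λ (s , eq) → bit≢1⇒true (Z (x + x)) λ eq′ → avoids s (trans eq (sym eq′))) ,
  (λ (s , eq) x∈ → avoids s (trans eq (cong bit (sym x∈))))
  where
  avoids : ∀ s → U s (dec x) ≢ bit (Z (x + x))
  avoids s eq = even-≢ good s (dec x) (trans eq (cong (λ k → bit (Z (k + k))) (sym (enc-dec x))))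

-- If `c` computed the odd half, its value at the code of a tree with head `⌜ c ⌝` would be the very
-- bit that `odd-≢` forbids.
Good⇒≰ : ∀ {Z} → Good Z → ¬ (odds Z ≤T evens Z)
Good⇒≰ {Z} good (c , χ) =
  let (N , r) = J-complete Z (λ {x} p → p) (λ {x} → ∉⇒false x) c (nat 0) (↓value (Z (suc (k + k))) refl)
  in odd-≢ good N d (trans (r N ≤-refl) (verdict-bit (Z (suc (k + k)))))
  where
  d : Tree
  d = ⌜ c ⌝ ∙ nat 0
  k : ℕ
  k = enc d
  value : Bool → ℕ
  value false = 0
  value true  = 1
  verdict-bit : ∀ b → verdict (value b) ≡ bit b
  verdict-bit false = refl
  verdict-bit true  = refl
  ↓value : ∀ b → Z (suc (k + k)) ≡ b → evens Z ⊢ c · k ∷ [] ↓ value b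
  ↓value true  eq = proj₁ (χ k) eq
  ↓value false eq = proj₂ (χ k) λ eq′ → contradiction (trans (sym eq) eq′) λ ()
  ∉⇒false : ∀ x → x ∉ evens Z → Z (x + x) ≡ false
  ∉⇒false x x∉ = ¬-not x∉

-- Dead strings

-- A finite certificate that every path through `σ` has a bad prefix. Such certificates can be
-- searched for, and by `split` a string without one has a child without one.
data Dead (σ : Tree) : Set where
  bad   : Bad σ → Dead σ
  split : Dead (⟦ appendᵗ false ⟧ σ) → Dead (⟦ appendᵗ true ⟧ σ) → Dead σ

-- Following `Z` through the certificate would end at a bad prefix of `Z`.
Good⇒alive : ∀ {Z} → Good Z → ∀ L → ¬ Dead (prefix Z L)
Good⇒alive {Z} good L dead = go L (prefix Z L) refl dead
  where
  go : ∀ L σ → σ ≡ prefix Z L → ¬ Dead σ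
  go L σ refl (bad p) = Good⇒¬Bad good L p
  go L σ refl (split p q) with Z L in eq
  ... | false = go (suc L) (⟦ appendᵗ false ⟧ (prefix Z L)) (cong (λ b → ⟦ appendᵗ b ⟧ (prefix Z L)) (sym eq)) p
  ... | true  = go (suc L) (⟦ appendᵗ true ⟧ (prefix Z L)) (cong (λ b → ⟦ appendᵗ b ⟧ (prefix Z L)) (sym eq)) q

AllDead : Tree → Set
AllDead (nat _) = ⊤
AllDead (σ ∙ W) = Dead σ × AllDead W

opaque
  -- Depth-first search through a list of strings, which empties the list if and
  -- only if all of them are dead.
  exploreᵗ : Term
  exploreᵗ = ifz idᵗ 0ᵗ
    (ifz (badᵗ ⊙ hd) tl (appendᵗ false ⊙ hd ,ᵗ appendᵗ true ⊙ hd ,ᵗ tl))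

-- The remaining list and the remaining number of steps are arbitrary, so that the searches below
-- two siblings can be run in succession.
Discards : Tree → Set
Discards σ = ∃ λ k → ∀ W j → iterate ⟦ exploreᵗ ⟧ (σ ∙ W) (k + j) ≡ iterate ⟦ exploreᵗ ⟧ W j

opaque
  unfolding exploreᵗ

  explore-bad : ∀ {σ} → Bad σ → Discards σ
  explore-bad p = 1 , λ W j → cong (λ V → iterate ⟦ exploreᵗ ⟧ V j) (if0-zero p)

  explore-dead : ∀ {σ} → Dead σ → Discards σ
  explore-dead (bad p) = explore-bad p
  explore-dead {σ} (split p q) with zero? (⟦ badᵗ ⟧ σ)
  -- The search tests a string before expanding it, so a bad string is dropped at once even if the
  -- certificate splits it.
  ... | inj₁ p′ = explore-bad p′
  ... | inj₂ ≢0 =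
    let (k , eq) = explore-dead p ; (l , eq′) = explore-dead q
    in suc (k + l) , λ W j → trans
         (cong₂ (iterate ⟦ exploreᵗ ⟧) (if0-nonzero ≢0) (+-assoc k l j))
         (trans (eq (⟦ appendᵗ true ⟧ σ ∙ W) (l + j)) (eq′ W j))

  explore-sound : ∀ k W → iterate ⟦ exploreᵗ ⟧ W k ≡ nat 0 → AllDead W
  explore-sound k       (nat _) _  = _
  explore-sound (suc k) (σ ∙ W) eq with zero? (⟦ badᵗ ⟧ σ)
  ... | inj₁ p  = bad p ,
    explore-sound k W (trans (cong (λ V → iterate ⟦ exploreᵗ ⟧ V k) (sym (if0-zero p))) eq)
  ... | inj₂ ≢0 =
    let (p , q , r) = explore-sound k (⟦ appendᵗ false ⟧ σ ∙ ⟦ appendᵗ true ⟧ σ ∙ W)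
          (trans (cong (λ V → iterate ⟦ exploreᵗ ⟧ V k) (sym (if0-nonzero ≢0))) eq)
    in split p q , r

opaque
  -- The slot between stage and string is for the code of the searching program, which `W-complete`
  -- places in front of the argument.
  childᵗ : Bool → Term
  childᵗ b = iter exploreᵗ ⊙ (hd ,ᵗ appendᵗ b ⊙ tl ⊙ tl ,ᵗ 0ᵗ)

  ⟦childᵗ⟧ : ∀ b s e σ → ⟦ childᵗ b ⟧ (nat s ∙ e ∙ σ) ≡
             iterate ⟦ exploreᵗ ⟧ (⟦ appendᵗ b ⟧ σ ∙ nat 0) s
  ⟦childᵗ⟧ b s e σ = iterate-is-fold (⟦ appendᵗ b ⟧ σ ∙ nat 0) ⟦ exploreᵗ ⟧ s

child-dead : ∀ σ b e → Dead (⟦ appendᵗ b ⟧ σ) → ∃ λ s → ⟦ childᵗ b ⟧ (nat s ∙ e ∙ σ) ≡ nat 0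
child-dead σ b e dead =
  let (k , eq) = explore-dead dead
  in k + 0 , trans (⟦childᵗ⟧ b (k + 0) e σ) (eq (nat 0) 0)

child-alive : ∀ σ b s e → ¬ Dead (⟦ appendᵗ b ⟧ σ) → ⟦ childᵗ b ⟧ (nat s ∙ e ∙ σ) ≢ nat 0
child-alive σ b s e alive eq =
  alive (proj₁ (explore-sound s (⟦ appendᵗ b ⟧ σ ∙ nat 0) (trans (sym (⟦childᵗ⟧ b s e σ)) eq)))

eitherᵗ whichᵗ : Term
eitherᵗ = ifz (childᵗ false) 0ᵗ (childᵗ true)
whichᵗ  = ifz (childᵗ true) 1ᵗ 0ᵗ

stageᶜ : Code 2
stageᶜ = comp nodeᶜ (comp natᶜ (proj zero ∷ []) ∷ proj (suc zero) ∷ [])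

firstDeadᶜ : Code 1
firstDeadᶜ = comp (comp (code whichᵗ) (stageᶜ ∷ []))
                  (μ (comp (code eitherᵗ) (stageᶜ ∷ [])) ∷ proj zero ∷ [])

output : Bool → ℕ
output b = enc (nat (if b then 1 else 0))

-- The search halts because child `b` is dead. As the other child is alive, the stage found can only
-- be due to child `b`.
↓firstDead : ∀ σ b e → Dead (⟦ appendᵗ b ⟧ σ) → ¬ Dead (⟦ appendᵗ (not b) ⟧ σ) →
             A ⊢ firstDeadᶜ · enc (e ∙ σ) ∷ [] ↓ output b
↓firstDead {A = A} σ b e dead alive =
  let (s , eq)       = child-dead σ b e dead
      (s′ , eq′ , p) = ↓search (λ s → enc (⟦ eitherᵗ ⟧ (nat s ∙ e ∙ σ))) (↓at eitherᵗ)
                         s (trans (cong enc (either b s eq)) pair-00)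
  in ↓comp₂ p (↓proj zero)
       (↓-resp (cong enc (which b s′ (enc≡0⇒ _ eq′) alive)) (↓at whichᵗ s′))
  where
  ↓at : ∀ t s → A ⊢ comp (code t) (stageᶜ ∷ []) · s ∷ enc (e ∙ σ) ∷ [] ↓ enc (⟦ t ⟧ (nat s ∙ e ∙ σ))
  ↓at t s = ↓comp₁
    (↓comp₂ (↓comp₁ (↓proj zero) (↓nat s)) (↓proj (suc zero)) (↓node (nat s) (e ∙ σ)))
    (↓code t (nat s ∙ e ∙ σ))

  either : ∀ b s → ⟦ childᵗ b ⟧ (nat s ∙ e ∙ σ) ≡ nat 0 → ⟦ eitherᵗ ⟧ (nat s ∙ e ∙ σ) ≡ nat 0
  either false s eq = if0-zero eq
  either true  s eq with zero? (⟦ childᵗ false ⟧ (nat s ∙ e ∙ σ))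
  ... | inj₁ eq′ = if0-zero eq′
  ... | inj₂ ≢0  = trans (if0-nonzero ≢0) eq

  which : ∀ b s → ⟦ eitherᵗ ⟧ (nat s ∙ e ∙ σ) ≡ nat 0 → ¬ Dead (⟦ appendᵗ (not b) ⟧ σ) →
          ⟦ whichᵗ ⟧ (nat s ∙ e ∙ σ) ≡ nat (if b then 1 else 0)
  which false s eq alive = if0-nonzero (child-alive σ true s e alive)
  which true  s eq alive = if0-zero (trans (sym (if0-nonzero (child-alive σ false s e alive))) eq)

opaque
  firstDead : Tree
  firstDead = ⌜ firstDeadᶜ ⌝

  -- A separator has to point to the living child here: a dead `false` child forces membership, a
  -- dead `true` child excludes it.
  W-firstDead : ∀ σ b → Dead (⟦ appendᵗ b ⟧ σ) → ¬ Dead (⟦ appendᵗ (not b) ⟧ σ) →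
                W (bit b) (enc (firstDead ∙ σ))
  W-firstDead σ b dead alive = subst (λ t → W t (enc (firstDead ∙ σ))) (verdict-output b)
    (W-complete firstDeadᶜ σ (↓firstDead σ b firstDead dead alive))
    where
    verdict-output : ∀ b → verdict (output b) ≡ bit b
    verdict-output false = cong verdict pair-00
    verdict-output true  = cong verdict pair-01

-- The path computed from a separator

module Path (em : ExcludedMiddle 0ℓ) {C : Pred ℕ 0ℓ} (sep : Separator C) where

  choice : Tree → Bool
  choice σ = does (em {enc (firstDead ∙ σ) ∈ C})

  path : ℕ → Tree
  path zero    = zeros 0
  path (suc n) = ⟦ appendᵗ (choice (path n)) ⟧ (path n)

  Z : ℕ → Bool
  Z n = choice (path n)

  path≡prefix : ∀ n → path n ≡ prefix Z n
  path≡prefix zero    = refl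
  path≡prefix (suc n) = cong ⟦ appendᵗ (Z n) ⟧ (path≡prefix n)

  -- If the chosen child were dead, the other would be alive, since otherwise `split` would make `σ`
  -- dead. But then `W-firstDead` puts the queried point on the opposite side of `C`.
  choice-alive : ∀ σ → ¬ Dead σ → ¬ Dead (⟦ appendᵗ (choice σ) ⟧ σ)
  choice-alive σ alive dead with em {enc (firstDead ∙ σ) ∈ C}
  ... | yes ∈C = proj₂ (sep _) (W-firstDead σ true dead (λ dead′ → alive (split dead′ dead))) ∈C
  ... | no ∉C  = ∉C (proj₁ (sep _) (W-firstDead σ false dead (λ dead′ → alive (split dead dead′))))

  path-alive : ∀ n → ¬ Dead (path n)
  path-alive zero    = Good⇒alive (proj₂ (good-exists em)) 0
  path-alive (suc n) = choice-alive (path n) (path-alive n)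

  Z-good : Good Z
  Z-good = ¬Bad⇒Good λ L p → path-alive L (bad (subst Bad (sym (path≡prefix L)) p))

  selectᵗ : Term
  selectᵗ = ifz hd (appendᵗ false ⊙ tl) (appendᵗ true ⊙ tl)

  pathᶜ : Code 1
  pathᶜ = prec (constᶜ (enc (zeros 0))) (comp (code selectᵗ)
    (comp nodeᶜ
      (comp natᶜ (comp oracle
        (comp nodeᶜ (constᶜ (enc firstDead) ∷ proj (suc zero) ∷ []) ∷ []) ∷ []) ∷
       proj (suc zero) ∷ []) ∷ []))

  ↓choice : ∀ σ → ∃ λ q → C ⊢ oracle · enc (firstDead ∙ σ) ∷ [] ↓ q ×
                          ⟦ selectᵗ ⟧ (nat q ∙ σ) ≡ ⟦ appendᵗ (choice σ) ⟧ σ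
  ↓choice σ with em {enc (firstDead ∙ σ) ∈ C}
  ... | yes ∈C = 1 , ↓oracle-∈ ∈C , refl
  ... | no ∉C  = 0 , ↓oracle-∉ ∉C , refl

  ↓path : ∀ n → C ⊢ pathᶜ · n ∷ [] ↓ enc (path n)
  ↓path zero    = ↓prec-zero (↓const (enc (zeros 0)))
  ↓path (suc n) =
    let (q , p , eq) = ↓choice (path n)
    in ↓prec-suc (↓path n) (↓comp₁
         (↓comp₂
           (↓comp₁ (↓comp₁ (↓comp₂ (↓const (enc firstDead)) (↓proj (suc zero))
                                   (↓node firstDead (path n))) p) (↓nat q))
           (↓proj (suc zero)) (↓node (nat q) (path n)))
         (↓-resp (cong enc eq) (↓code selectᵗ (nat q ∙ path n))))

  Z-at : Code 1 → Code 1
  Z-at c = comp sndᶜ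
    -- The bit at `n` is the first entry stored in the prefix of length `n + 1`, and `pd` undoes the
    -- shift of `bit`.
    (comp (code (pd ⊙ hd ⊙ tl)) (comp pathᶜ (comp sucᶜ (c ∷ []) ∷ []) ∷ []) ∷ [])

  ↓Z-at : (f : ℕ → ℕ) {c : Code 1} → (∀ x → C ⊢ c · x ∷ [] ↓ f x) →
          ∀ x b → Z (f x) ≡ b → C ⊢ Z-at c · x ∷ [] ↓ val (⟦ pd ⟧ (bit b))
  ↓Z-at f ↓c x b refl = ↓comp₁ (↓comp₁ (↓comp₁ (↓comp₁ (↓c x) ↓suc) (↓path (suc (f x))))
    (↓code (pd ⊙ hd ⊙ tl) (path (suc (f x))))) (↓val (⟦ pd ⟧ (bit (Z (f x)))))

  positions-≤T : (f : ℕ → ℕ) (c : Code 1) → (∀ x → C ⊢ c · x ∷ [] ↓ f x) →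
                 (λ x → Z (f x) ≡ true) ≤T C
  positions-≤T f c ↓c = Z-at c ,
    λ x → (λ eq → ↓Z-at f ↓c x true eq) , (λ ≢true → ↓Z-at f ↓c x false (¬-not ≢true))

  doubleᶜ : Code 1
  doubleᶜ = comp addᶜ (proj zero ∷ proj zero ∷ [])

  ↓double : ∀ x → C ⊢ doubleᶜ · x ∷ [] ↓ x + x
  ↓double x = ↓comp₂ (↓proj zero) (↓proj zero) (↓add x x)

  evens-≤T : evens Z ≤T C
  evens-≤T = positions-≤T (λ x → x + x) doubleᶜ ↓double

  odds-≤T : odds Z ≤T C
  odds-≤T = positions-≤T (λ x → suc (x + x)) (comp sucᶜ (doubleᶜ ∷ []))
    λ x → ↓comp₁ (↓double x) ↓suc

separator-exists : ExcludedMiddle 0ℓ → ∃ Separator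
separator-exists em = let (Z , good) = good-exists em in evens Z , Good⇒separator good

smaller-separator : ExcludedMiddle 0ℓ → ∀ {C} → Separator C →
                    ∃ λ D → Separator D × D ≤T C × ¬ (C ≤T D)
smaller-separator em {C} sep =
  evens Z , Good⇒separator Z-good , evens-≤T , λ C≤X → Good⇒≰ Z-good (≤T-trans odds-≤T C≤X)
  where open Path em sep

-- Spectra without minimal elements

open _IsBasisOf_

-- Below a basis element `b` lies a strictly smaller `c` of the set, and below `c` another basis
-- element `d`. Then `d` is below `b` but not equivalent to it, as that would put `b` below `c`.
no-minimal⇒no-basis : ∀ {ℓ} (𝒜 : DegreeSet 0ℓ) → (∃ λ a → a ∈D 𝒜) →
                      (∀ a → a ∈D 𝒜 → ∃ λ c → c ∈D 𝒜 × c ≤T a × ¬ (a ≤T c)) →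
                      ¬ (∃ λ (ℬ : DegreeSet ℓ) → ℬ IsBasisOf 𝒜)
no-minimal⇒no-basis 𝒜 (a , a∈𝒜) smaller (ℬ , basis)
  with (b , b∈ℬ , _) ← Equivalence.to (basis .generates a) a∈𝒜
  with (c , c∈𝒜 , c≤b , b≰c) ← smaller b (Equivalence.from (basis .generates b) (b , b∈ℬ , ≤T-refl))
  with (d , d∈ℬ , d≤c) ← Equivalence.to (basis .generates c) c∈𝒜 =
  proj₁ (basis .incomparable d∈ℬ b∈ℬ λ d≈b → b≰c (≤T-trans (Deg.reflexive (Deg.Eq.sym d≈b)) d≤c))
    (≤T-trans d≤c c≤b)

spectrum-no-minimal : ExcludedMiddle 0ℓ → ∀ A → A ∈D DgSp⇒ R._∼_ S._∼_ →
                      ∃ λ D → D ∈D DgSp⇒ R._∼_ S._∼_ × D ≤T A × ¬ (A ≤T D)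
spectrum-no-minimal em A A∈ =
  let (C , C-sep , C≤A)       = reduction⇒separator em A∈
      (D , D-sep , D≤C , C≰D) = smaller-separator em C-sep
  in D , separator⇒reduction em D-sep , ≤T-trans D≤C C≤A , λ A≤D → C≰D (≤T-trans C≤A A≤D)

theorem4p3 : ExcludedMiddle 0ℓ →
    ∃₂ λ (R S : Ceer) →
    InfinitelyManyClasses (Ceer._∼_ R) × InfinitelyManyClasses (Ceer._∼_ S) ×
    ¬ (∃ λ (ℬ : DegreeSet (lsuc 0ℓ)) → ℬ IsBasisOf DgSp⇒ (Ceer._∼_ R) (Ceer._∼_ S))
theorem4p3 em = R.ceer , S.ceer , R-infinite , S-infinite ,
  no-minimal⇒no-basis (DgSp⇒ R._∼_ S._∼_)
    (let (C , sep) = separator-exists em in C , separator⇒reduction em sep)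
    (spectrum-no-minimal em)
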